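{- There is a single sentence $\varphi$ of first-order logic in the language of graphs such that for all $k \geq 1$ \[ \lim_{n \to \infty} \frac{\left|\{\mathcal{G} \in \mathbb{G}_k(n) : \mathcal{G} \models \varphi\}\right|}{\left|\mathbb{G}_k(n)\right|} \notin \{0, 1\}. \]
   Context: Notation: $\omega=\{0,1,2,\dots\}$ and $[m]=\{0,1,\dots,m-1\}$; $\mathcal{P}(Z)$ is the power set of $Z$; $k$ and $n$ range over $\omega$. Graphs are simple undirected graphs. The language of graphs has a single binary relation symbol $E$ for adjacency (and equality). For $k,n\in\omega$, a $k$-rainbow sequence on $[n]$ is a pair $S=(a,e)$ of functions $a:[n]\to[k]$ and $e:[n]\to\mathcal{P}([k])$. The graph associated with $S$ is the graph on vertex set $[n]$ in which, for all $x<y$ in $[n]$, $x$ and $y$ are adjacent if and only if $a(x)\in e(y)$. $\mathbb{G}_k(n)$ denotes the set of all (labelled) graphs on vertex set $[n]$ that are associated with some $k$-rainbow sequence on $[n]$ (the $k$-rainbow threshold graphs on $[n]$). -}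

module Defs where

open import Data.Bool.Base using (true; false)
open import Data.Empty using (⊥)
open import Data.Fin.Base using (Fin; zero; suc; _<_)
open import Data.Fin.Properties using (all?; any?; _<?_; <-cmp; <-irrefl; <-asym)
  renaming (_≟_ to _≟ᶠ_)
open import Data.Fin.Subset using (Subset; _∈_) renaming (⊥ to ⊥ˢ)
open import Data.Fin.Subset.Properties using (_∈?_)
open import Data.Integer.Base using (+_)
open import Data.List.Base
  using (List; []; _∷_; map; filter; length; cartesianProduct; cartesianProductWith; deduplicate; allFin)
open import Data.List.Membership.Propositional using () renaming (_∈_ to _∈ˡ_)
open import Data.List.Membership.Propositional.Properties
  using (∈-cartesianProduct⁺; ∈-cartesianProductWith⁺; ∈-allFin)
import Data.List.Membership.Propositional.Properties as Propositional
import Data.List.Membership.Setoid as SetoidMembership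
import Data.List.Membership.Setoid.Properties as SetoidProperties
import Data.List.Relation.Unary.Any as Any
import Data.List.Relation.Unary.Any.Properties as AnyProperties
open import Data.List.Relation.Unary.Any using (here; there)
import Data.List.Relation.Unary.Unique.DecSetoid as UniqueDec
import Data.List.Relation.Unary.Unique.DecSetoid.Properties as UniqueDecProperties
open import Data.Nat.Base as ℕ using (ℕ; zero; suc; NonZero)
open import Data.Product.Base using (Σ-syntax; ∃-syntax; _×_; _,_; proj₁; proj₂)
open import Data.Rational.Base as ℚ using (ℚ; 0ℚ; 1ℚ; ∣_∣; _-_; _/_)
import Data.Rational.Properties as ℚₚ
open import Data.Sum.Base using (_⊎_; inj₁; inj₂; swap)
open import Data.Vec.Base using (Vec; []; _∷_; lookup; replicate)
open import Function.Base using (_∘_; id)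
open import Function.Bundles using (_⇔_; mk⇔; Equivalence)
open import Level using (0ℓ) renaming (suc to ℓsuc)
open import Relation.Binary.Bundles using (DecSetoid)
open import Relation.Binary.Definitions using (Decidable; Symmetric; Irreflexive; tri<; tri≈; tri>)
open import Relation.Binary.PropositionalEquality using (_≡_; refl; sym; subst)
open import Relation.Nullary using (Dec; no; ¬_; ¬?; _×-dec_; _⊎-dec_; _→-dec_; contradiction)
open import Relation.Nullary.Decidable using (map′)

record Graph (n : ℕ) : Set₁ where
  infix 4 _~_ _~?_
  field
    _~_      : Fin n → Fin n → Set
    ~-sym    : Symmetric _~_
    ~-irrefl : Irreflexive _≡_ _~_
    _~?_     : Decidable _~_

open Graph

-- Equality of labelled graphs, not isomorphism.
infix 4 _≈_
record _≈_ {n : ℕ} (G H : Graph n) : Set where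
  constructor mk≈
  field
    edges : ∀ x y → _~_ G x y ⇔ _~_ H x y

≈-decSetoid : ℕ → DecSetoid (ℓsuc 0ℓ) 0ℓ
≈-decSetoid n = record
  { Carrier = Graph n
  ; _≈_ = _≈_
  ; isDecEquivalence = record
    { isEquivalence = record
      { refl  = mk≈ λ _ _ → mk⇔ id id
      ; sym   = λ (mk≈ p) → mk≈ λ x y → mk⇔ (from (p x y)) (to (p x y))
      ; trans = λ (mk≈ p) (mk≈ q) → mk≈ λ x y →
          mk⇔ (to (q x y) ∘ to (p x y)) (from (p x y) ∘ from (q x y))
      }
    ; _≟_ = λ G H → map′ mk≈ _≈_.edges
        (all? λ x → all? λ y →
          map′ (λ (f , g) → mk⇔ f g) (λ e → to e , from e)
            ((_~?_ G x y →-dec _~?_ H x y) ×-dec (_~?_ H x y →-dec _~?_ G x y)))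
    }
  }
  where open Equivalence

-- Formulas whose free variables are de Bruijn indices below m.
infix  7 _≐_
infixr 6 _∧_
infixr 5 _∨_
infixr 4 _⇒_
data Formula (m : ℕ) : Set where
  E           : (i j : Fin m) → Formula m
  _≐_         : (i j : Fin m) → Formula m
  ⊥′          : Formula m
  ¬′_         : Formula m → Formula m
  _∧_ _∨_ _⇒_ : Formula m → Formula m → Formula m
  ∀′_ ∃′_     : Formula (suc m) → Formula m

Sentence : Set
Sentence = Formula 0

infix 3 _⊨_[_]
_⊨_[_] : ∀ {n m} → Graph n → Formula m → Vec (Fin n) m → Set
G ⊨ E i j [ ρ ]   = _~_ G (lookup ρ i) (lookup ρ j)
G ⊨ i ≐ j [ ρ ]   = lookup ρ i ≡ lookup ρ j
G ⊨ ⊥′ [ ρ ]      = ⊥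
G ⊨ ¬′ φ [ ρ ]    = ¬ (G ⊨ φ [ ρ ])
G ⊨ φ ∧ ψ [ ρ ]   = (G ⊨ φ [ ρ ]) × (G ⊨ ψ [ ρ ])
G ⊨ φ ∨ ψ [ ρ ]   = (G ⊨ φ [ ρ ]) ⊎ (G ⊨ ψ [ ρ ])
G ⊨ φ ⇒ ψ [ ρ ]   = (G ⊨ φ [ ρ ]) → (G ⊨ ψ [ ρ ])
G ⊨ ∀′ φ [ ρ ]    = ∀ x → G ⊨ φ [ x ∷ ρ ]
G ⊨ ∃′ φ [ ρ ]    = ∃[ x ] (G ⊨ φ [ x ∷ ρ ])

infix 3 _⊨_ _⊨?_
_⊨_ : ∀ {n} → Graph n → Sentence → Set
G ⊨ φ = G ⊨ φ [ [] ]

⊨-dec : ∀ {n m} (G : Graph n) (φ : Formula m) (ρ : Vec (Fin n) m) → Dec (G ⊨ φ [ ρ ])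
⊨-dec G (E i j) ρ = _~?_ G (lookup ρ i) (lookup ρ j)
⊨-dec G (i ≐ j) ρ = lookup ρ i ≟ᶠ lookup ρ j
⊨-dec G ⊥′      ρ = no λ ()
⊨-dec G (¬′ φ)  ρ = ¬? (⊨-dec G φ ρ)
⊨-dec G (φ ∧ ψ) ρ = ⊨-dec G φ ρ ×-dec ⊨-dec G ψ ρ
⊨-dec G (φ ∨ ψ) ρ = ⊨-dec G φ ρ ⊎-dec ⊨-dec G ψ ρ
⊨-dec G (φ ⇒ ψ) ρ = ⊨-dec G φ ρ →-dec ⊨-dec G ψ ρ
⊨-dec G (∀′ φ)  ρ = all? λ x → ⊨-dec G φ (x ∷ ρ)
⊨-dec G (∃′ φ)  ρ = any? λ x → ⊨-dec G φ (x ∷ ρ)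

_⊨?_ : ∀ {n} (G : Graph n) (φ : Sentence) → Dec (G ⊨ φ)
G ⊨? φ = ⊨-dec G φ []

-- The functions a : [n] → [k] and e : [n] → 𝒫([k]) are stored as tables.
RainbowSequence : ℕ → ℕ → Set
RainbowSequence k n = Vec (Fin k) n × Vec (Subset k) n

module _ {k n : ℕ} (S : RainbowSequence k n) where

  a : Fin n → Fin k
  a = lookup (proj₁ S)

  e : Fin n → Subset k
  e = lookup (proj₂ S)

  IsAssociated : Graph n → Set
  IsAssociated G = ∀ {x y} → x < y → _~_ G x y ⇔ a x ∈ e y

  associated : Graph n
  associated = record
    { _~_      = λ x y → (x < y × a x ∈ e y) ⊎ (y < x × a y ∈ e x)
    ; ~-sym    = swap
    ; ~-irrefl = λ { refl (inj₁ (x<x , _)) → <-irrefl refl x<x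
                   ; refl (inj₂ (x<x , _)) → <-irrefl refl x<x }
    ; _~?_     = λ x y → (x <? y ×-dec (a x ∈? e y)) ⊎-dec (y <? x ×-dec (a y ∈? e x))
    }

  associated-isAssociated : IsAssociated associated
  associated-isAssociated {x} {y} x<y = mk⇔
    (λ { (inj₁ (_ , p)) → p ; (inj₂ (y<x , _)) → contradiction y<x (<-asym x<y) })
    (λ p → inj₁ (x<y , p))

  isAssociated⇒≈associated : ∀ {G} → IsAssociated G → G ≈ associated
  isAssociated⇒≈associated {G} assoc = mk≈ λ x y → mk⇔ (⇒ᴬ x y) λ where
      (inj₁ (x<y , p)) → from (assoc x<y) p
      (inj₂ (y<x , p)) → ~-sym G (from (assoc y<x) p)
    where
    open Equivalence
    ⇒ᴬ : ∀ x y → _~_ G x y → _~_ associated x y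
    ⇒ᴬ x y p with <-cmp x y
    ... | tri< x<y _ _  = inj₁ (x<y , to (assoc x<y) p)
    ... | tri≈ _ x≡y _  = contradiction p (~-irrefl G x≡y)
    ... | tri> _ _ y<x  = inj₂ (y<x , to (assoc y<x) (~-sym G p))

  isAssociated-resp-≈ : ∀ {G H} → G ≈ H → IsAssociated H → IsAssociated G
  isAssociated-resp-≈ (mk≈ p) assoc x<y = mk⇔
    (to (assoc x<y) ∘ to (p _ _)) (from (p _ _) ∘ from (assoc x<y))
    where open Equivalence

IsRainbow : (k : ℕ) {n : ℕ} → Graph n → Set
IsRainbow k {n} G = Σ[ S ∈ RainbowSequence k n ] IsAssociated S G

allVec : ∀ {A : Set} → List A → ∀ n → List (Vec A n)
allVec xs zero    = [] ∷ []
allVec xs (suc n) = cartesianProductWith _∷_ xs (allVec xs n)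

allRainbowSequences : ∀ k n → List (RainbowSequence k n)
allRainbowSequences k n =
  cartesianProduct (allVec (allFin k) n) (allVec (allVec (true ∷ false ∷ []) k) n)

-- The set 𝔾ₖ(n), as a repetition-free list up to _≈_; see ∈𝔾⇔isRainbow and 𝔾-unique.
𝔾 : ∀ k n → List (Graph n)
𝔾 k n = deduplicate (DecSetoid._≟_ (≈-decSetoid n)) (map associated (allRainbowSequences k n))

allVec-complete : ∀ {A : Set} {xs : List A} → (∀ x → x ∈ˡ xs) →
                  ∀ {n} (v : Vec A n) → v ∈ˡ allVec xs n
allVec-complete all []      = here refl
allVec-complete all (x ∷ v) = ∈-cartesianProductWith⁺ _∷_ (all x) (allVec-complete all v)

allRainbowSequences-complete : ∀ {k n} (S : RainbowSequence k n) → S ∈ˡ allRainbowSequences k n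
allRainbowSequences-complete (as , es) = ∈-cartesianProduct⁺
  (allVec-complete ∈-allFin as)
  (allVec-complete (allVec-complete λ { true → here refl ; false → there (here refl) }) es)

module _ {n : ℕ} where
  open DecSetoid (≈-decSetoid n) using (setoid; trans; _≟_) renaming (sym to ≈-sym)
  open SetoidMembership setoid using () renaming (_∈_ to _∈ᴳ_)

  ∈𝔾⇔isRainbow : ∀ k (G : Graph n) → G ∈ᴳ 𝔾 k n ⇔ IsRainbow k G
  ∈𝔾⇔isRainbow k G = mk⇔ sound complete
    where
    sound : G ∈ᴳ 𝔾 k n → IsRainbow k G
    sound G∈𝔾 with Any.satisfied (AnyProperties.map⁻ (SetoidProperties.∈-deduplicate⁻ setoid _≟_ _ G∈𝔾))
    ... | S , G≈ = S , isAssociated-resp-≈ S G≈ (associated-isAssociated S)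

    complete : IsRainbow k G → G ∈ᴳ 𝔾 k n
    complete (S , assoc) = SetoidProperties.∈-deduplicate⁺ setoid _≟_
      (λ p q → trans q (≈-sym p))
      (Any.map (λ { refl → isAssociated⇒≈associated S assoc })
        (Propositional.∈-map⁺ associated (allRainbowSequences-complete S)))

𝔾-unique : ∀ k n → UniqueDec.Unique (≈-decSetoid n) (𝔾 k n)
𝔾-unique k n = UniqueDecProperties.deduplicate-! (≈-decSetoid n) _

𝔾-nonEmpty : ∀ k .{{_ : NonZero k}} n → NonZero (length (𝔾 k n))
𝔾-nonEmpty (suc k) n = helper (Equivalence.from (∈𝔾⇔isRainbow (suc k) (associated S)) (S , associated-isAssociated S))
  where
  S : RainbowSequence (suc k) n
  S = replicate n zero , replicate n ⊥ˢ

  helper : ∀ {P : Graph n → Set} {Gs : List (Graph n)} → Any.Any P Gs → NonZero (length Gs)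
  helper (here _)  = _
  helper (there _) = _

proportion : Sentence → ∀ k .{{_ : NonZero k}} → ℕ → ℚ
proportion φ k n = + length (filter (_⊨? φ) (𝔾 k n)) / length (𝔾 k n)
  where instance _ = 𝔾-nonEmpty k n

Eventually : (ℕ → Set) → Set
Eventually P = ∃[ N ] (∀ n → N ℕ.≤ n → P n)

-- Reals as Cauchy sequences of rationals, compared by _≃_.
record ℝ : Set where
  field
    approx : ℕ → ℚ
    cauchy : ∀ ε → 0ℚ ℚ.< ε →
             ∃[ N ] (∀ m n → N ℕ.≤ m → N ℕ.≤ n → ∣ approx m - approx n ∣ ℚ.< ε)

open ℝ

infix 4 _≃_
_≃_ : ℝ → ℝ → Set
x ≃ y = ∀ ε → 0ℚ ℚ.< ε → Eventually λ n → ∣ approx x n - approx y n ∣ ℚ.< ε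

fromℚ : ℚ → ℝ
fromℚ q = record
  { approx = λ _ → q
  ; cauchy = λ ε 0<ε → 0 , λ _ _ _ _ → subst (λ z → ∣ z ∣ ℚ.< ε) (sym (ℚₚ.+-inverseʳ q)) 0<ε
  }

0ℝ 1ℝ : ℝ
0ℝ = fromℚ 0ℚ
1ℝ = fromℚ 1ℚ

-- The real inequality |q − x| < ε: the strict bound must survive passing to
-- the limit of the approximations of x, hence the intermediate δ.
∣_−_∣<_ : ℚ → ℝ → ℚ → Set
∣ q − x ∣< ε = ∃[ δ ] (δ ℚ.< ε × Eventually λ m → ∣ q - approx x m ∣ ℚ.≤ δ)

infix 4 _⟶_
_⟶_ : (ℕ → ℚ) → ℝ → Set
s ⟶ L = ∀ ε → 0ℚ ℚ.< ε → Eventually λ n → ∣ s n − L ∣< ε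

{-# OPTIONS --safe #-}

-- The sentence says that some vertex is isolated. Call a word (the sequence of
-- the pairs (a(x), e(x))) generic at a position if every colour occurs before
-- it and every singleton palette after it. Then the palettes {i} recover the
-- colours of the earlier vertices, so a vertex inserted at that position gives
-- exactly K = k 2^k graphs, and insertion neither creates nor destroys isolated
-- vertices. Words that are not generic at the middle position are exponentially
-- rare, whereas |𝔾 k n| ≥ K^(n - 2k). Hence, up to relatively exponentially
-- small errors, passing from n to n + 1 multiplies both |𝔾 k n| and the number
-- of graphs with an isolated vertex by K, and the proportions form a Cauchy
-- sequence. They stay away from 0 and 1, because appending an isolated or a
-- dominating vertex embeds 𝔾 k n in 𝔾 k (n + 1) and
-- |𝔾 k (n + 1)| ≤ K^(2k + 1) |𝔾 k n|.
module Submission where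

open import Defs
open import Data.Nat.Base using (ℕ; NonZero)
open import Data.Product.Base using (Σ-syntax; ∃-syntax; _×_; _,_; proj₁; proj₂)
open import Data.Sum.Base using (_⊎_; inj₁; inj₂; [_,_]′)
open import Relation.Binary.PropositionalEquality
open import Relation.Nullary using (¬_; contradiction)

-- The obstacle is that one graph has many words, so counting words does not count graphs.
-- Genericity belongs to a word, while the count needs every graph `G` on n + 1 vertices to arise
-- from the one generic word chosen for `G ∖ p`, even when `G` itself is known only through an
-- unrelated word `v`. The late singleton palettes settle this: they force `v` and the chosen word
-- to colour the earlier vertices alike up to a permutation of the colours, and the letter of `v` at
-- `p` can be translated along it.
--
-- The position is central because colours must show up before it and singletons after it: a
-- uniformly random word fails on either side with probability at most about k (1 - 1/K)^(n/2). This
-- beats the bounded factor K^(2k) that separates the number of words from the number of graphs.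
-- Since only ratios of counts at n and n + 1 are compared, the value of |𝔾 k n| / K^n never has to
-- be determined.

module Combinatorics where

  open import Data.Bool.Base using (true; false)
  import Data.Bool.Properties as Boolₚ
  open import Data.Fin.Base using (Fin; zero; suc; toℕ; fromℕ; fromℕ<; punchIn; punchOut; _↑ˡ_; _↑ʳ_)
    renaming (_<_ to _<ᶠ_)
  open import Data.Fin.Properties
    using (all?; any?; ¬∀⟶∃¬; injective⇒≤; punchOut-injective; punchIn-punchOut;
           toℕ-fromℕ<; toℕ-fromℕ; toℕ<n; toℕ-↑ˡ; toℕ-↑ʳ)
    renaming (_≟_ to _≟ᶠ_)
  open import Data.Fin.Subset using (Subset; _∈_; ⁅_⁆) renaming (⊥ to ∅; ⊤ to full)
  open import Data.Fin.Subset.Properties using (x∈⁅x⁆; x∈⁅y⁆⇒x≡y; ⊆-antisym; ∉⊥; ∈⊤)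
  open import Data.List.Base as List
    using (List; []; _∷_; _++_; filter; length; cartesianProduct; cartesianProductWith; allFin; concatMap)
  open import Data.List.Properties
    using (length-map; length-++; length-tabulate; length-filter; filter-notAll; filter-all)
  open import Data.List.Membership.Propositional using (find; lose) renaming (_∈_ to _∈ˡ_)
  open import Data.List.Membership.Propositional.Properties
    using (∈-lookup; ∈-allFin; ∈-cartesianProduct⁺; ∈-cartesianProduct⁻; ∈-cartesianProductWith⁺;
           ∈-filter⁺; ∈-filter⁻; ∈-++⁺ˡ; ∈-++⁺ʳ; ∈-map⁺; ∈-concatMap⁺)
  open import Data.List.Relation.Unary.All as All using ()
  open import Data.List.Relation.Unary.AllPairs as AllPairs using (AllPairs; []; _∷_)
  open import Data.List.Relation.Unary.Any as Any using (here; there; index)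
  open import Data.List.Relation.Unary.Any.Properties using (lookup-index)
  open import Data.List.Relation.Unary.Unique.Propositional using (Unique)
  import Data.List.Relation.Unary.Unique.Propositional.Properties as Unique
  open import Data.Nat.Base hiding (NonZero; ℕ)
  open import Data.Nat.Properties
  open import Data.Nat.Tactic.RingSolver using (solve-∀)
  open import Data.Product.Properties using () renaming (≡-dec to ×-≡-dec)
  open import Data.Vec.Base as Vec using (Vec; []; _∷_; lookup; insertAt; removeAt; tabulate)
  open import Data.Vec.Properties
    using (insertAt-lookup; insertAt-punchIn; insertAt-removeAt; lookup-map; lookup-zip; lookup∘tabulate;
           lookup-++ˡ; lookup-++ʳ; []=⇒lookup; lookup⇒[]=; ∷-injective; ≡-dec)
  open import Function.Base using (_∘_; _$_)
  open import Function.Bundles using (_⇔_; mk⇔; Equivalence)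
  open import Function.Construct.Composition using (_⇔-∘_)
  open import Function.Construct.Symmetry using (⇔-sym)
  open import Level using (Level)
  open import Relation.Binary.Bundles using (DecSetoid)
  open import Relation.Binary.Core using (Rel; REL)
  open import Relation.Binary.Definitions using (DecidableEquality; Symmetric)
  open import Relation.Nullary using (Dec; yes; no; _×-dec_; ¬?)
  open import Relation.Nullary.Decidable using (map′)
  open import Relation.Unary using (Pred; Decidable)

  open Equivalence using (to; from)
  open Graph using (_~_; ~-sym; ~-irrefl; _~?_)

  private
    variable
      ℓ ℓ₁ ℓ₂ ℓ₃ : Level
      X : Set ℓ₁
      Y : Set ℓ₂
      Z : Set ℓ₃
      k m n : ℕ

  -- Counting finite lists by injective relations

  lookup-injective : {xs : List X} → Unique xs → ∀ i j → List.lookup xs i ≡ List.lookup xs j → i ≡ j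
  lookup-injective (_   ∷ _)  zero    zero    _  = refl
  lookup-injective (x∉ ∷ _)   zero    (suc j) eq = contradiction eq (All.lookup x∉ (∈-lookup j))
  lookup-injective (x∉ ∷ _)   (suc i) zero    eq = contradiction (sym eq) (All.lookup x∉ (∈-lookup i))
  lookup-injective (_   ∷ xs!) (suc i) (suc j) eq = cong suc (lookup-injective xs! i j eq)

  -- A relation takes the place of a function because codes come from existence proofs such as
  -- `∃[ w ] Represents w G`, where no choice is canonical. It is enough that no code serves two
  -- elements.
  length-≤ : {xs : List X} {ys : List Y} (R : REL X Y ℓ) → Unique xs →
             (∀ {x} → x ∈ˡ xs → ∃[ y ] (y ∈ˡ ys × R x y)) →
             (∀ {x x′ y} → x ∈ˡ xs → x′ ∈ˡ xs → R x y → R x′ y → x ≡ x′) →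
             length xs ≤ length ys
  length-≤ {xs = xs} {ys} R xs! total injective = injective⇒≤ λ {i} {j} → f-injective i j
    where
    image : ∀ i → ∃[ y ] (y ∈ˡ ys × R (List.lookup xs i) y)
    image i = total (∈-lookup i)

    f : Fin (length xs) → Fin (length ys)
    f i = index (proj₁ (proj₂ (image i)))

    f-related : ∀ i → R (List.lookup xs i) (List.lookup ys (f i))
    f-related i with image i
    ... | y , y∈ys , r = subst (R _) (lookup-index y∈ys) r

    f-injective : ∀ i j → f i ≡ f j → i ≡ j
    f-injective i j eq = lookup-injective xs! i j
      (injective (∈-lookup i) (∈-lookup j) (f-related i)
        (subst (R _ ∘ List.lookup ys) (sym eq) (f-related j)))

  length-≤-⊆ : {xs ys : List X} → Unique xs → (∀ {x} → x ∈ˡ xs → x ∈ˡ ys) → length xs ≤ length ys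
  length-≤-⊆ xs! xs⊆ys = length-≤ _≡_ xs! (λ x∈ → _ , xs⊆ys x∈ , refl) (λ { _ _ refl refl → refl })

  -- `𝔾` is repetition-free up to `_≈_`; this converts `_≈_` between its members into the
  -- propositional equality used in counting.
  pairwise-≉⇒≈-injective : {_≈_ : Rel X ℓ} {xs : List X} → Symmetric _≈_ → AllPairs (λ x y → ¬ x ≈ y) xs →
                        ∀ {x y} → x ∈ˡ xs → y ∈ˡ xs → x ≈ y → x ≡ y
  pairwise-≉⇒≈-injective ≈-sym _          (here refl) (here refl) _ = refl
  pairwise-≉⇒≈-injective ≈-sym (x≉ ∷ _)   (here refl) (there y∈)  e = contradiction e (All.lookup x≉ y∈)
  pairwise-≉⇒≈-injective ≈-sym (x≉ ∷ _)   (there x∈)  (here refl) e =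
    contradiction (≈-sym e) (All.lookup x≉ x∈)
  pairwise-≉⇒≈-injective ≈-sym (_  ∷ xs≉) (there x∈)  (there y∈)  e =
    pairwise-≉⇒≈-injective ≈-sym xs≉ x∈ y∈ e

  length-cartesianProductWith : (f : X → Y → Z) (xs : List X) (ys : List Y) →
                                length (cartesianProductWith f xs ys) ≡ length xs * length ys
  length-cartesianProductWith f []       ys = refl
  length-cartesianProductWith f (x ∷ xs) ys = trans (length-++ (List.map (f x) ys))
    (cong₂ _+_ (length-map (f x) ys) (length-cartesianProductWith f xs ys))

  length-filter-¬ : {P : Pred X ℓ} (P? : Decidable P) (xs : List X) →
                    length (filter P? xs) + length (filter (¬? ∘ P?) xs) ≡ length xs
  length-filter-¬ P? []       = refl
  length-filter-¬ P? (x ∷ xs) with P? x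
  ... | yes _ = cong suc (length-filter-¬ P? xs)
  ... | no  _ = trans (+-suc _ _) (cong suc (length-filter-¬ P? xs))

  Fin-injective⇒surjective : (f : Fin n → Fin n) → (∀ {i j} → f i ≡ f j → i ≡ j) → ∀ j → ∃[ i ] (f i ≡ j)
  Fin-injective⇒surjective {suc n} f f-injective j with any? (λ i → f i ≟ᶠ j)
  ... | yes hit  = hit
  ... | no  miss = contradiction
    (injective⇒≤ {f = λ i → punchOut (j≢f i)} (λ {x} {y} eq → f-injective (punchOut-injective (j≢f x) (j≢f y) eq)))
    1+n≰n
    where
    j≢f : ∀ i → j ≢ f i
    j≢f i j≡fi = miss (i , sym j≡fi)

  -- Order and position under `punchIn`

  punchIn-mono-< : ∀ (p : Fin (suc n)) {x y} → x <ᶠ y → punchIn p x <ᶠ punchIn p y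
  punchIn-mono-< zero                    x<y = s<s x<y
  punchIn-mono-< (suc p) {zero}  {suc y} x<y = z<s
  punchIn-mono-< (suc p) {suc x} {suc y} x<y = s<s (punchIn-mono-< p (s<s⁻¹ x<y))

  punchIn-cancel-< : ∀ (p : Fin (suc n)) {x y} → punchIn p x <ᶠ punchIn p y → x <ᶠ y
  punchIn-cancel-< zero                    x<y = s<s⁻¹ x<y
  punchIn-cancel-< (suc p) {zero}  {suc y} x<y = z<s
  punchIn-cancel-< (suc p) {suc x} {suc y} x<y = s<s (punchIn-cancel-< p (s<s⁻¹ x<y))

  toℕ-punchIn-< : ∀ (p : Fin (suc n)) {x} → toℕ x < toℕ p → toℕ (punchIn p x) ≡ toℕ x
  toℕ-punchIn-< (suc p) {zero}  x<p = refl
  toℕ-punchIn-< (suc p) {suc x} x<p = cong suc (toℕ-punchIn-< p (s<s⁻¹ x<p))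

  toℕ-punchIn-≥ : ∀ (p : Fin (suc n)) {x} → toℕ p ≤ toℕ x → toℕ (punchIn p x) ≡ suc (toℕ x)
  toℕ-punchIn-≥ zero            p≤x = refl
  toℕ-punchIn-≥ (suc p) {suc x} p≤x = cong suc (toℕ-punchIn-≥ p (s≤s⁻¹ p≤x))

  punchIn-< : ∀ (p : Fin (suc n)) {x} → toℕ x < toℕ p → punchIn p x <ᶠ p
  punchIn-< p x<p = subst (_< toℕ p) (sym (toℕ-punchIn-< p x<p)) x<p

  punchIn-> : ∀ (p : Fin (suc n)) {x} → toℕ p ≤ toℕ x → p <ᶠ punchIn p x
  punchIn-> p p≤x = subst (toℕ p <_) (sym (toℕ-punchIn-≥ p p≤x)) (s≤s p≤x)

  punchIn-<⁻¹ : ∀ (p : Fin (suc n)) {x} → punchIn p x <ᶠ p → toℕ x < toℕ p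
  punchIn-<⁻¹ p {x} px<p with toℕ x <? toℕ p
  ... | yes x<p = x<p
  ... | no  x≮p = contradiction px<p (<-asym (punchIn-> p (≮⇒≥ x≮p)))

  punchIn->⁻¹ : ∀ (p : Fin (suc n)) {x} → p <ᶠ punchIn p x → toℕ p ≤ toℕ x
  punchIn->⁻¹ p {x} p<px with toℕ x <? toℕ p
  ... | yes x<p = contradiction p<px (<-asym (punchIn-< p x<p))
  ... | no  x≮p = ≮⇒≥ x≮p

  data PunchInView {n : ℕ} (p : Fin (suc n)) : Fin (suc n) → Set where
    pivot   : PunchInView p p
    punched : ∀ x → PunchInView p (punchIn p x)

  punchInView : (p x : Fin (suc n)) → PunchInView p x
  punchInView p x with p ≟ᶠ x
  ... | yes refl = pivot
  ... | no  p≢x  = subst (PunchInView p) (punchIn-punchOut p≢x) (punched (punchOut p≢x))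

  -- Words and the graphs they represent

  Letter : ℕ → Set
  Letter k = Fin k × Subset k

  -- One vector of pairs in place of a pair of vectors, so that adding or deleting a vertex is a
  -- single `insertAt` or `removeAt`.
  Word : ℕ → ℕ → Set
  Word k n = Vec (Letter k) n

  colour : Word k n → Fin n → Fin k
  colour w x = proj₁ (lookup w x)

  palette : Word k n → Fin n → Subset k
  palette w x = proj₂ (lookup w x)

  record Represents (w : Word k n) (G : Graph n) : Set where
    constructor represents
    field
      adjacency : ∀ {x y} → x <ᶠ y → _~_ G x y ⇔ colour w x ∈ palette w y

  open Represents

  rainbowSequence : Word k n → RainbowSequence k n
  rainbowSequence w = Vec.map proj₁ w , Vec.map proj₂ w

  isAssociated⇔represents : (w : Word k n) {G : Graph n} → IsAssociated (rainbowSequence w) G ⇔ Represents w G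
  isAssociated⇔represents w {G} = mk⇔
    (λ assoc → represents λ {x} {y} x<y →
      subst₂ (λ i P → _~_ G x y ⇔ i ∈ P) (lookup-map x proj₁ w) (lookup-map y proj₂ w) (assoc x<y))
    (λ rep {x} {y} x<y →
      subst₂ (λ i P → _~_ G x y ⇔ i ∈ P) (sym (lookup-map x proj₁ w)) (sym (lookup-map y proj₂ w)) (adjacency rep x<y))

  graph : Word k n → Graph n
  graph w = associated (rainbowSequence w)

  represents-graph : (w : Word k n) → Represents w (graph w)
  represents-graph w = to (isAssociated⇔represents w) (associated-isAssociated (rainbowSequence w))

  represents⇒≈graph : {w : Word k n} {G : Graph n} → Represents w G → G ≈ graph w
  represents⇒≈graph {w =
    w} {G} rep = isAssociated⇒≈associated (rainbowSequence w) {G} (from (isAssociated⇔represents w) rep)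

  represents-resp-≈ : {w : Word k n} {G H : Graph n} → G ≈ H → Represents w H → Represents w G
  represents-resp-≈ (mk≈ G≈H) rep = represents λ x<y → adjacency rep x<y ⇔-∘ G≈H _ _

  isRainbow⇔represented : {G : Graph n} → IsRainbow k G ⇔ (∃[ w ] Represents {k} w G)
  isRainbow⇔represented {G = G} = mk⇔
    (λ { ((as , es) , assoc) → Vec.zip as es , represents λ {x} {y} x<y →
         subst₂ (λ i P → _~_ G x y ⇔ i ∈ P)
           (sym (cong proj₁ (lookup-zip x as es))) (sym (cong proj₂ (lookup-zip y as es))) (assoc x<y) })
    (λ (w , rep) → rainbowSequence w , from (isAssociated⇔represents w) rep)

  -- Vertex deletion and letter insertion

  infixl 6 _∖_
  _∖_ : Graph (suc n) → Fin (suc n) → Graph n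
  G ∖ p = record
    { _~_      = λ x y → _~_ G (punchIn p x) (punchIn p y)
    ; ~-sym    = ~-sym G
    ; ~-irrefl = λ { refl → ~-irrefl G refl }
    ; _~?_     = λ x y → _~?_ G (punchIn p x) (punchIn p y)
    }

  ∖-cong : {G H : Graph (suc n)} (p : Fin (suc n)) → G ≈ H → G ∖ p ≈ H ∖ p
  ∖-cong p (mk≈ G≈H) = mk≈ λ x y → G≈H (punchIn p x) (punchIn p y)

  module _ {w : Word k n} {p : Fin (suc n)} {l : Letter k} {G : Graph (suc n)} where

    private
      w′ : Word k (suc n)
      w′ = insertAt w p l

      Edge⇔ : Fin (suc n) → Fin (suc n) → Letter k → Letter k → Set
      Edge⇔ x y lˣ lʸ = _~_ G x y ⇔ proj₁ lˣ ∈ proj₂ lʸ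

    represents-∖ : Represents w′ G → Represents w (G ∖ p)
    represents-∖ rep =
      represents λ {x} {y} x<y → subst₂ (Edge⇔ _ _) (insertAt-punchIn w p l x) (insertAt-punchIn w p l y)
      (adjacency rep (punchIn-mono-< p x<y))

    represents-before : Represents w′ G → ∀ {x} → toℕ x < toℕ p → _~_ G (punchIn p x) p ⇔ colour w x ∈ proj₂ l
    represents-before rep {x} x<p =
      subst₂ (Edge⇔ _ _) (insertAt-punchIn w p l x) (insertAt-lookup w p l) (adjacency rep (punchIn-< p x<p))

    represents-after : Represents w′ G → ∀ {y} → toℕ p ≤ toℕ y → _~_ G p (punchIn p y) ⇔ proj₁ l ∈ palette w y
    represents-after rep {y} p≤y =
      subst₂ (Edge⇔ _ _) (insertAt-lookup w p l) (insertAt-punchIn w p l y) (adjacency rep (punchIn-> p p≤y))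

    represents-insertAt : Represents w (G ∖ p) →
                          (∀ {x} → toℕ x < toℕ p → _~_ G (punchIn p x) p ⇔ colour w x ∈ proj₂ l) →
                          (∀ {y} → toℕ p ≤ toℕ y → _~_ G p (punchIn p y) ⇔ proj₁ l ∈ palette w y) →
                          Represents w′ G
    represents-insertAt rep before after = represents λ {x} {y} → adjacent x y
      where
      adjacent : ∀ x y → x <ᶠ y → Edge⇔ x y (lookup w′ x) (lookup w′ y)
      adjacent x y x<y with punchInView p x | punchInView p y
      ... | pivot     | pivot     = contradiction x<y (<-irrefl refl)
      ... | punched x | pivot     =
          subst₂ (Edge⇔ _ _) (sym (insertAt-punchIn w p l x)) (sym (insertAt-lookup w p l)) (before (punchIn-<⁻¹ p x<y))
      ... | pivot     | punched y =
          subst₂ (Edge⇔ _ _) (sym (insertAt-lookup w p l)) (sym (insertAt-punchIn w p l y)) (after (punchIn->⁻¹ p x<y))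
      ... | punched x | punched y =
          subst₂ (Edge⇔ _ _) (sym (insertAt-punchIn w p l x)) (sym (insertAt-punchIn w p l y)) (adjacency rep (punchIn-cancel-< p x<y))

  represents-removeAt : {w : Word k (suc n)} (p : Fin (suc n)) {G : Graph (suc n)} →
                        Represents w G → Represents (removeAt w p) (G ∖ p)
  represents-removeAt {w =
    w} p {G} rep = represents-∖ (subst (λ w → Represents w G) (sym (insertAt-removeAt w p)) rep)

  -- Generic positions and one-vertex extensions

  record Generic (m : ℕ) (w : Word k n) : Set where
    field
      early         : Fin k → Fin n
      early<m       : ∀ i → toℕ (early i) < m
      colour-early  : ∀ i → colour w (early i) ≡ i
      late          : Fin k → Fin n
      m≤late        : ∀ i → m ≤ toℕ (late i)
      palette-late  : ∀ i → palette w (late i) ≡ ⁅ i ⁆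

  generic? : ∀ m (w : Word k n) → Dec (Generic m w)
  generic? m w = map′
    (λ (earlies , lates) → record
      { early        = λ i → proj₁ (earlies i)
      ; early<m      = λ i → proj₁ (proj₂ (earlies i))
      ; colour-early = λ i → proj₂ (proj₂ (earlies i))
      ; late         = λ i → proj₁ (lates i)
      ; m≤late       = λ i → proj₁ (proj₂ (lates i))
      ; palette-late = λ i → proj₂ (proj₂ (lates i))
      })
    (λ g → let open Generic g in
      (λ i → early i , early<m i , colour-early i) , (λ i → late i , m≤late i , palette-late i))
    (all? (λ i → any? λ x → (toℕ x <? m) ×-dec (colour w x ≟ᶠ i)) ×-dec
     all? (λ i → any? λ x → (m ≤? toℕ x) ×-dec (≡-dec Boolₚ._≟_ (palette w x) ⁅ i ⁆)))

  module _ {w : Word k n} {p : Fin (suc n)} (generic : Generic (toℕ p) w) where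
    open Generic generic

    early<late : ∀ i j → early i <ᶠ late j
    early<late i j = <-≤-trans (early<m i) (m≤late j)

    insertAt-generic : ∀ l → Generic (toℕ p) (insertAt w p l)
    insertAt-generic l = record
      { early        = λ i → punchIn p (early i)
      ; early<m      = λ i → punchIn-< p (early<m i)
      ; colour-early = λ i → trans (cong proj₁ (insertAt-punchIn w p l (early i))) (colour-early i)
      ; late         = λ i → punchIn p (late i)
      ; m≤late       = λ i → <⇒≤ (punchIn-> p (m≤late i))
      ; palette-late = λ i → trans (cong proj₂ (insertAt-punchIn w p l (late i))) (palette-late i)
      }

    module _ {G : Graph (suc n)} where

      -- The graph shows the inserted letter: the new vertex is adjacent to the shifted `late i`
      -- exactly when `i` is its colour, and to the shifted `early i` exactly when `i` lies in its
      -- palette.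
      insertion-unique : ∀ {l l′} → Represents (insertAt w p l) G → Represents (insertAt w p l′) G → l ≡ l′
      insertion-unique {i , P} {j , Q} rep rep′ = cong₂ _,_
        (sym (x∈⁅y⁆⇒x≡y i (subst (j ∈_) (palette-late i)
          (to (represents-after rep′ (m≤late i)) (from (represents-after rep (m≤late i))
            (subst (i ∈_) (sym (palette-late i)) (x∈⁅x⁆ i)))))))
        (⊆-antisym (transfer rep rep′) (transfer rep′ rep))
        where
        transfer : ∀ {l l′} → Represents (insertAt w p l) G → Represents (insertAt w p l′) G →
                   ∀ {i} → i ∈ proj₂ l → i ∈ proj₂ l′
        transfer {l} {l′} rep rep′ {i} i∈P = subst (_∈ proj₂ l′) (colour-early i)
          (to (represents-before rep′ (early<m i)) (from (represents-before rep (early<m i))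
            (subst (_∈ proj₂ l) (sym (colour-early i)) i∈P)))

      -- The colours used by w and by v on the vertices before p correspond by
      -- the permutation σ, since late i is adjacent to exactly the earlier
      -- vertices to which w gives colour i.
      insertion-exists : (v : Word k (suc n)) → Represents w (G ∖ p) → Represents v G →
                         ∃[ l ] Represents (insertAt w p l) G
      insertion-exists v rep-w rep-v = l , represents-insertAt rep-w before after
        where
        same-colour : ∀ {x x′} → toℕ x < toℕ p → toℕ x′ < toℕ p →
                      colour v (punchIn p x) ≡ colour v (punchIn p x′) → colour w x ≡ colour w x′
        same-colour {x} {x′} x<p x′<p eq = sym (x∈⁅y⁆⇒x≡y i (subst (colour w x′ ∈_) (palette-late i)
            (to (adjacency rep-w (<-≤-trans x′<p (m≤late i)))
              (from (adjacency rep-v (punchIn-mono-< p (<-≤-trans x′<p (m≤late i))))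
                (subst (_∈ palette v (punchIn p (late i))) eq
                  (to (adjacency rep-v (punchIn-mono-< p (<-≤-trans x<p (m≤late i))))
                    (from (adjacency rep-w (<-≤-trans x<p (m≤late i)))
                      (subst (i ∈_) (sym (palette-late i)) (x∈⁅x⁆ i)))))))))
          where i = colour w x

        σ : Fin k → Fin k
        σ i = colour v (punchIn p (early i))

        σ-surjective : ∀ j → ∃[ i ] (σ i ≡ j)
        σ-surjective = Fin-injective⇒surjective σ λ {i} {j} eq → begin
          i                   ≡⟨ colour-early i ⟨
          colour w (early i)  ≡⟨ same-colour (early<m i) (early<m j) eq ⟩
          colour w (early j)  ≡⟨ colour-early j ⟩
          j                   ∎
          where open ≡-Reasoning

        σ-colour : ∀ {x} → toℕ x < toℕ p → σ (colour w x) ≡ colour v (punchIn p x)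
        σ-colour {x} x<p with σ-surjective (colour v (punchIn p x))
        ... | i , σi≡ =
            trans (cong σ (trans (same-colour x<p (early<m i) (sym σi≡)) (colour-early i))) σi≡

        -- Translating the letter of `v` at `p` into the colours of `w` pulls both components back
        -- along σ; the colour has a preimage only because σ is onto.
        c = proj₁ (σ-surjective (colour v p))

        l : Letter k
        l = c , tabulate (λ i → lookup (palette v p) (σ i))

        before : ∀ {x} → toℕ x < toℕ p → _~_ G (punchIn p x) p ⇔ colour w x ∈ proj₂ l
        before {x} x<p = mk⇔
            (λ e → lookup⇒[]= i _ (trans (lookup∘tabulate _ i)
              ([]=⇒lookup (subst (_∈ palette v p) (sym (σ-colour x<p)) (to (adjacency rep-v (punchIn-< p x<p)) e)))))
            (λ i∈ → from (adjacency rep-v (punchIn-< p x<p)) (subst (_∈ palette v p) (σ-colour x<p)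
               (lookup⇒[]= (σ i) _ (trans (sym (lookup∘tabulate _ i)) ([]=⇒lookup i∈)))))
          where i = colour w x

        after : ∀ {y} → toℕ p ≤ toℕ y → _~_ G p (punchIn p y) ⇔ c ∈ palette w y
        -- In `v`, the vertex `p` and the shifted `early c` share a colour, hence have the same
        -- neighbours after `p`; for `early c` these are known from `w`.
        after {y} p≤y = subst (λ i → _~_ G p (punchIn p y) ⇔ i ∈ palette w y) (colour-early c)
          (adjacency rep-w x<y ⇔-∘ (⇔-sym (adjacency rep-v (punchIn-mono-< p x<y)) ⇔-∘
            (subst (λ i → _~_ G p (punchIn p y) ⇔ i ∈ palette v (punchIn p y)) (sym (proj₂ (σ-surjective (colour v p))))
              (adjacency rep-v (punchIn-> p p≤y)))))
          where
          x<y : early c <ᶠ y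
          x<y = <-≤-trans (early<m c) p≤y

  module ≈ {n : ℕ} = DecSetoid (≈-decSetoid n)

  -- Counting words and bounding the nongeneric ones

  length-concatMap-≤ : (f : X → List Y) (c : ℕ) → (∀ x → length (f x) ≤ c) → ∀ xs → length (concatMap f xs) ≤ length xs * c
  length-concatMap-≤ f c bound []       = z≤n
  length-concatMap-≤ f c bound (x ∷ xs) = begin
    length (concatMap f (x ∷ xs))              ≡⟨ length-++ (f x) ⟩
    length (f x) + length (concatMap f xs)     ≤⟨ +-mono-≤ (bound x) (length-concatMap-≤ f c bound xs) ⟩
    c + length xs * c                          ∎
    where open ≤-Reasoning

  length-allVec : (xs : List X) → ∀ n → length (allVec xs n) ≡ length xs ^ n
  length-allVec xs zero    = refl
  length-allVec xs (suc n) =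
    trans (length-cartesianProductWith _∷_ xs _) (cong (length xs *_) (length-allVec xs n))

  allVec-unique : {xs : List X} → Unique xs → ∀ n → Unique (allVec xs n)
  allVec-unique xs! zero    = All.[] AllPairs.∷ AllPairs.[]
  allVec-unique xs! (suc n) = Unique.cartesianProductWith⁺ _∷_ ∷-injective xs! (allVec-unique xs! n)

  box : List X → List X → ℕ → ∀ n → List (Vec X n)
  box xs ys m       zero    = [] ∷ []
  box xs ys zero    (suc n) = cartesianProductWith _∷_ ys (box xs ys zero n)
  box xs ys (suc m) (suc n) = cartesianProductWith _∷_ xs (box xs ys m n)

  ∈-box : {xs ys : List X} → ∀ m (v : Vec X n) →
          (∀ i → toℕ i < m → lookup v i ∈ˡ xs) → (∀ i → m ≤ toℕ i → lookup v i ∈ˡ ys) → v ∈ˡ box xs ys m n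
  ∈-box m       []      before after = here refl
  ∈-box zero    (x ∷ v) before after = ∈-cartesianProductWith⁺ _∷_ (after zero z≤n)
    (∈-box zero v (λ i ()) (λ i _ → after (suc i) z≤n))
  ∈-box (suc m) (x ∷ v) before after = ∈-cartesianProductWith⁺ _∷_ (before zero z<s)
    (∈-box m v (λ i i<m → before (suc i) (s<s i<m)) (λ i m≤i → after (suc i) (s≤s m≤i)))

  length-box : (xs ys : List X) → m ≤ n → length (box xs ys m n) ≡ length xs ^ m * length ys ^ (n ∸ m)
  length-box {n = zero}  xs ys z≤n = refl
  length-box {n = suc n} xs ys z≤n = begin
    length (box xs ys 0 (suc n))           ≡⟨ length-cartesianProductWith _∷_ ys _ ⟩
    length ys * length (box xs ys 0 n)     ≡⟨ cong (length ys *_) (length-box {n = n} xs ys z≤n) ⟩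
    length ys * (1 * length ys ^ n)        ≡⟨ cong (length ys *_) (*-identityˡ _) ⟩
    length ys ^ suc n                      ≡⟨ *-identityˡ _ ⟨
    1 * length ys ^ suc n                  ∎
    where open ≡-Reasoning
  length-box {m = suc m} {n = suc n} xs ys (s≤s m≤n) = begin
    length (box xs ys (suc m) (suc n))                     ≡⟨ length-cartesianProductWith _∷_ xs _ ⟩
    length xs * length (box xs ys m n)
      ≡⟨ cong (length xs *_) (length-box xs ys m≤n) ⟩
    length xs * (length xs ^ m * length ys ^ (n ∸ m))      ≡⟨ *-assoc (length xs) _ _ ⟨
    length xs ^ suc m * length ys ^ (n ∸ m)                ∎
    where open ≡-Reasoning

  letters : ∀ k → List (Letter k)
  letters k = cartesianProduct (allFin k) (allVec (true ∷ false ∷ []) k)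

  ∈-letters : (l : Letter k) → l ∈ˡ letters k
  ∈-letters (i , P) = ∈-cartesianProduct⁺ (∈-allFin i)
    (allVec-complete (λ { true → here refl ; false → there (here refl) }) P)

  letters-unique : ∀ k → Unique (letters k)
  letters-unique k = Unique.cartesianProduct⁺ (Unique.allFin⁺ k)
    (allVec-unique (((λ ()) All.∷ All.[]) AllPairs.∷ All.[] AllPairs.∷ AllPairs.[]) k)

  length-letters : ∀ k → length (letters k) ≡ k * 2 ^ k
  length-letters k = trans (length-cartesianProductWith _,_ (allFin k) _)
    (cong₂ _*_ (length-tabulate {n = k} _) (length-allVec _ k))

  words : ∀ k n → List (Word k n)
  words k n = allVec (letters k) n

  ∈-words : (w : Word k n) → w ∈ˡ words k n
  ∈-words = allVec-complete ∈-letters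

  length-words : ∀ k n → length (words k n) ≡ (k * 2 ^ k) ^ n
  length-words k n = trans (length-allVec (letters k) n) (cong (_^ n) (length-letters k))

  _≟ˡ_ : DecidableEquality (Letter k)
  _≟ˡ_ = ×-≡-dec _≟ᶠ_ (≡-dec Boolₚ._≟_)

  -- A single letter that witnesses both the colour `i` and the palette `⁅ i ⁆`. If every mark
  -- occurs on both sides, the position is generic; so a nongeneric word avoids some fixed letter
  -- throughout one side, which leaves K - 1 choices at each place there.
  mark : Fin k → Letter k
  mark i = i , ⁅ i ⁆

  lettersExcept : Letter k → List (Letter k)
  lettersExcept {k} l = filter (¬? ∘ (_≟ˡ l)) (letters k)

  length-lettersExcept : (l : Letter k) → length (lettersExcept l) ≤ pred (k * 2 ^ k)
  length-lettersExcept {k} l = subst (λ K → length (lettersExcept l) ≤ pred K) (length-letters k)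
    (<⇒≤pred (filter-notAll (¬? ∘ (_≟ˡ l)) (letters k) (lose (∈-letters l) (λ l≢l → l≢l refl))))

  -- A cover of the nongeneric words that may repeat words and contain generic ones; its length
  -- enters only as an upper bound.
  nonGeneric : ∀ k m n → List (Word k n)
  nonGeneric k m n = concatMap
    (λ i → box (lettersExcept (mark i)) (letters k) m n ++ box (letters k) (lettersExcept (mark i)) m n)
    (allFin k)

  ¬generic⇒∈nonGeneric : ∀ m (w : Word k n) → ¬ Generic m w → w ∈ˡ nonGeneric k m n
  ¬generic⇒∈nonGeneric {k} m w ¬generic
    with all? (λ i → any? λ x → (toℕ x <? m) ×-dec (lookup w x ≟ˡ mark i))
       | all? (λ i → any? λ x → (m ≤? toℕ x) ×-dec (lookup w x ≟ˡ mark i))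
  ... | yes early | yes late = contradiction generic ¬generic
    where
    generic : Generic m w
    generic = record
      { early        = λ i → proj₁ (early i)
      ; early<m      = λ i → proj₁ (proj₂ (early i))
      ; colour-early = λ i → cong proj₁ (proj₂ (proj₂ (early i)))
      ; late         = λ i → proj₁ (late i)
      ; m≤late       = λ i → proj₁ (proj₂ (late i))
      ; palette-late = λ i → cong proj₂ (proj₂ (proj₂ (late i)))
      }
  ... | no ¬early | _ with ¬∀⟶∃¬ k _ (λ i → any? λ x → (toℕ x <? m) ×-dec (lookup w x ≟ˡ mark i)) ¬early
  ...   | i , missing = ∈-concatMap⁺ _ (lose (∈-allFin i) (∈-++⁺ˡ
            (∈-box m w (λ x x<m → ∈-filter⁺ _ (∈-letters _) (λ eq → missing (x , x<m , eq))) (λ _ _ → ∈-letters _))))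
  ¬generic⇒∈nonGeneric {k} m w ¬generic
      | yes _ | no ¬late with ¬∀⟶∃¬ k _ (λ i → any? λ x → (m ≤? toℕ x) ×-dec (lookup w x ≟ˡ mark i)) ¬late
  ...   | i , missing = ∈-concatMap⁺ _ (lose (∈-allFin i) (∈-++⁺ʳ _
            (∈-box m w (λ _ _ → ∈-letters _) (λ x m≤x → ∈-filter⁺ _ (∈-letters _) (λ eq → missing (x , m≤x , eq))))))

  -- Avoiding a letter on the right is at most as frequent as the bound for the left, because the
  -- right side is at least as long: K^m q^(n-m) ≤ q^m K^(n-m). The factors k and 2 count the marks
  -- and the sides.
  length-nonGeneric : ∀ k → m ≤ n ∸ m → m ≤ n →
    length (nonGeneric k m n) ≤ k * (2 * (pred (k * 2 ^ k) ^ m * (k * 2 ^ k) ^ (n ∸ m)))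
  length-nonGeneric {m} {n} k m≤n∸m m≤n = begin
    length (nonGeneric k m n)  ≤⟨ length-concatMap-≤ _ _ bound (allFin k) ⟩
    length (allFin k) * (2 * (q ^ m * K ^ r))
      ≡⟨ cong (_* (2 * (q ^ m * K ^ r))) (length-tabulate {n = k} _) ⟩
    k * (2 * (q ^ m * K ^ r))  ∎
    where
    open ≤-Reasoning
    K = k * 2 ^ k
    q = pred K
    r = n ∸ m

    bound : ∀ i → length (box (lettersExcept (mark i)) (letters k) m n ++ box (letters k) (lettersExcept (mark i)) m n)
                ≤ 2 * (q ^ m * K ^ r)
    bound i = begin
      length (box (lettersExcept (mark i)) (letters k) m n ++ box (letters k) (lettersExcept (mark i)) m n)
        ≡⟨ length-++ (box (lettersExcept (mark i)) (letters k) m n) ⟩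
      length (box (lettersExcept (mark i)) (letters k) m n) + length (box (letters k) (lettersExcept (mark i)) m n)
        ≡⟨ cong₂ _+_ (length-box (lettersExcept (mark i)) (letters k) m≤n) (length-box (letters k) (lettersExcept (mark i)) m≤n) ⟩
      x ^ m * length (letters k) ^ r + length (letters k) ^ m * x ^ r
        ≡⟨ cong (λ L → x ^ m * L ^ r + L ^ m * x ^ r) (length-letters k) ⟩
      x ^ m * K ^ r + K ^ m * x ^ r
        ≤⟨ +-mono-≤ (*-monoˡ-≤ _ (^-monoˡ-≤ m x≤q)) (*-monoʳ-≤ (K ^ m) (^-monoˡ-≤ r x≤q)) ⟩
      q ^ m * K ^ r + K ^ m * q ^ r
        ≤⟨ +-monoʳ-≤ (q ^ m * K ^ r) (begin
             K ^ m * q ^ r                    ≡⟨ cong (λ j → K ^ m * q ^ j) (m+[n∸m]≡n m≤n∸m) ⟨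
             K ^ m * q ^ (m + (r ∸ m))        ≡⟨ cong (K ^ m *_) (^-distribˡ-+-* q m (r ∸ m)) ⟩
             K ^ m * (q ^ m * q ^ (r ∸ m))    ≡⟨ *-assoc (K ^ m) _ _ ⟨
             K ^ m * q ^ m * q ^ (r ∸ m)      ≡⟨ cong (_* q ^ (r ∸ m)) (*-comm (K ^ m) _) ⟩
             q ^ m * K ^ m * q ^ (r ∸ m)
               ≤⟨ *-monoʳ-≤ (q ^ m * K ^ m) (^-monoˡ-≤ (r ∸ m) (pred[n]≤n {K})) ⟩
             q ^ m * K ^ m * K ^ (r ∸ m)      ≡⟨ *-assoc (q ^ m) _ _ ⟩
             q ^ m * (K ^ m * K ^ (r ∸ m))    ≡⟨ cong (q ^ m *_) (^-distribˡ-+-* K m (r ∸ m)) ⟨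
             q ^ m * K ^ (m + (r ∸ m))        ≡⟨ cong (λ j → q ^ m * K ^ j) (m+[n∸m]≡n m≤n∸m) ⟩
             q ^ m * K ^ r                    ∎) ⟩
      q ^ m * K ^ r + q ^ m * K ^ r
        ≡⟨ cong (q ^ m * K ^ r +_) (+-identityʳ _) ⟨
      2 * (q ^ m * K ^ r) ∎
      where
      x = length (lettersExcept (mark i))
      x≤q = length-lettersExcept (mark i)

  -- Members of `𝔾`, stable sentences and canonical extensions

  ∈𝔾⇒represented : {G : Graph n} → G ∈ˡ 𝔾 k n → ∃[ w ] Represents {k} w G
  ∈𝔾⇒represented {k = k} {G} G∈ = to isRainbow⇔represented
    (to (∈𝔾⇔isRainbow k G) (Any.map (λ { refl → ≈.refl }) G∈))

  represented⇒∃∈𝔾 : {w : Word k n} {G : Graph n} → Represents w G → ∃[ H ] (H ∈ˡ 𝔾 k n × G ≈ H)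
  represented⇒∃∈𝔾 {k} {w =
    w} {G} rep = find (from (∈𝔾⇔isRainbow k G) (from isRainbow⇔represented (w , rep)))

  𝔾-≈-injective : {G H : Graph n} → G ∈ˡ 𝔾 k n → H ∈ˡ 𝔾 k n → G ≈ H → G ≡ H
  𝔾-≈-injective {n} {k} = pairwise-≉⇒≈-injective {_≈_ = _≈_} ≈.sym (𝔾-unique k n)

  𝔾-unique-≡ : ∀ k n → Unique (𝔾 k n)
  𝔾-unique-≡ k n = AllPairs.map (λ { ≉ refl → ≉ ≈.refl }) (𝔾-unique k n)

  represents⇒≈ : {w : Word k n} {G H : Graph n} → Represents w G → Represents w H → G ≈ H
  represents⇒≈ rep-G rep-H = ≈.trans (represents⇒≈graph rep-G) (≈.sym (represents⇒≈graph rep-H))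

  models : Sentence → ∀ k n → List (Graph n)
  models φ k n = filter (_⊨? φ) (𝔾 k n)

  count : Sentence → ℕ → ℕ → ℕ
  count φ k n = length (models φ k n)

  -- What the recurrence asks of a sentence. Taking it as a hypothesis lets one argument count both
  -- all graphs, through `truth`, and those with an isolated vertex.
  record Stable (φ : Sentence) : Set₁ where
    field
      resp-≈   : {G H : Graph n} → G ≈ H → G ⊨ φ → H ⊨ φ
      insertAt-stable : {w : Word k n} {p : Fin (suc n)} {l : Letter k} {G : Graph (suc n)} → Generic (toℕ p) w →
                 Represents (insertAt w p l) G → (G ⊨ φ) ⇔ (G ∖ p ⊨ φ)

  abstract
    -- A word represents `G` exactly when `G ≈ graph w`, so a search through `words` decides this.
    -- `abstract` keeps the search from unfolding; later arguments use only that two calls with the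
    -- same arguments agree.
    genericRepresentation? : ∀ k m (G : Graph n) → Dec (∃[ w ] (Generic m w × Represents {k} w G))
    genericRepresentation? k m G = map′
      (λ any → let w , _ , generic , G≈w = find {P = λ w → Generic m w × G ≈ graph w} any in
        w , generic , represents-resp-≈ G≈w (represents-graph w))
      (λ (w , generic , rep) → lose (∈-words w) (generic , represents⇒≈graph rep))
      (Any.any? (λ w → generic? m w ×-dec (G ≈.≟ graph w)) (words k _))

  -- genericRepresentation? fixes one generic word per graph, so that the letter
  -- l determines the extension.
  record Extends (p : Fin (suc n)) (l : Letter k) (H : Graph n) (G : Graph (suc n)) : Set where
    constructor extends
    field
      {word}   : Word k n
      generic  : Generic (toℕ p) word
      rep      : Represents word H
      canonical : genericRepresentation? k (toℕ p) H ≡ yes (word , generic , rep)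
      rep-insertAt : Represents (insertAt word p l) G

  extends⇒≈∖ : {p : Fin (suc n)} {l : Letter k} {H : Graph n} {G : Graph (suc n)} → Extends p l H G → H ≈ G ∖ p
  extends⇒≈∖ (extends _ rep _ rep′) = represents⇒≈ rep (represents-∖ rep′)

  extends-functional : {p : Fin (suc n)} {l : Letter k} {H : Graph n} {G G′ : Graph (suc n)} →
                       Extends p l H G → Extends p l H G′ → G ≈ G′
  extends-functional (extends _ _ eq rep) (extends _ _ eq′ rep′) with trans (sym eq) eq′
  ... | refl = represents⇒≈ rep rep′

  extends-injective : {p : Fin (suc n)} {l l′ : Letter k} {H : Graph n} {G : Graph (suc n)} →
                      Extends p l H G → Extends p l′ H G → l ≡ l′
  extends-injective (extends generic _ eq rep) (extends _ _ eq′ rep′) with trans (sym eq) eq′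
  ... | refl = insertion-unique generic rep rep′

  -- The recurrence between n and n + 1 vertices

  module _ {φ : Sentence} (stable : Stable φ) where
    open Stable stable

    extends-stable : {p : Fin (suc n)} {l : Letter k} {H : Graph n} {G : Graph (suc n)} →
                     Extends p l H G → (G ⊨ φ) ⇔ (H ⊨ φ)
    extends-stable {G = G} ext@(extends generic _ _ rep) = mk⇔
      (λ G⊨φ → resp-≈ (≈.sym (extends⇒≈∖ ext)) (to (insertAt-stable {G = G} generic rep) G⊨φ))
      (λ H⊨φ → from (insertAt-stable {G = G} generic rep) (resp-≈ (extends⇒≈∖ ext) H⊨φ))

    module _ (k : ℕ) {n : ℕ} (p : Fin (suc n)) where
      private
        L = letters k
        N = nonGeneric k (toℕ p) n

      -- Take a word `v` for `G`. If deleting position `p` leaves a nongeneric word, that word and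
      -- the deleted letter code `G`. Otherwise `G` is coded by the copy of `G ∖ p` in `𝔾` and the
      -- letter whose insertion into the chosen generic word gives `G`.
      count-suc-≤ : count φ k (suc n) ≤ length L * count φ k n + length L * length N
      count-suc-≤ = subst (count φ k (suc n) ≤_) length-codes
        (length-≤ R (Unique.filter⁺ (_⊨? φ) (𝔾-unique-≡ k (suc n))) total R-injective)
        where
        codes : List (Letter k × Graph n ⊎ Letter k × Word k n)
        codes = List.map inj₁ (cartesianProduct L (models φ k n)) ++ List.map inj₂ (cartesianProduct L N)

        length-codes : length codes ≡ length L * count φ k n + length L * length N
        length-codes = trans (length-++ (List.map inj₁ (cartesianProduct L (models φ k n)))) (cong₂ _+_
          (trans (length-map inj₁ (cartesianProduct L (models φ k n))) (length-cartesianProductWith _,_ L (models φ k n)))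
          (trans (length-map inj₂ (cartesianProduct L N)) (length-cartesianProductWith _,_ L N)))

        R : Graph (suc n) → Letter k × Graph n ⊎ Letter k × Word k n → Set
        R G (inj₁ (l , H)) = Extends p l H G
        R G (inj₂ (l , w)) = Represents (insertAt w p l) G

        R-injective : ∀ {G G′ c} → G ∈ˡ models φ k (suc n) → G′ ∈ˡ models φ k (suc n) → R G c → R G′ c → G ≡ G′
        R-injective {G} {G′} {c} G∈ G′∈ r r′ = 𝔾-≈-injective {k = k}
          (proj₁ (∈-filter⁻ (_⊨? φ) G∈)) (proj₁ (∈-filter⁻ (_⊨? φ) G′∈)) (same c r r′)
          where
          same : ∀ c → R G c → R G′ c → G ≈ G′
          same (inj₁ (l , H)) r r′ = extends-functional r r′
          same (inj₂ (l , w)) r r′ = represents⇒≈ r r′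

        total : ∀ {G} → G ∈ˡ models φ k (suc n) → ∃[ c ] (c ∈ˡ codes × R G c)
        total {G} G∈ with ∈-filter⁻ (_⊨? φ) {xs = 𝔾 k (suc n)} G∈
        ... | G∈𝔾 , G⊨φ with ∈𝔾⇒represented {k = k} G∈𝔾
        ... | v , rep-v with generic? (toℕ p) (removeAt v p)
        ... | no ¬generic = inj₂ (lookup v p , removeAt v p) ,
                ∈-++⁺ʳ _ (∈-map⁺ inj₂ (∈-cartesianProduct⁺ (∈-letters _) (¬generic⇒∈nonGeneric (toℕ p) _ ¬generic))) ,
                subst (λ v → Represents v G) (sym (insertAt-removeAt v p)) rep-v
        ... | yes generic with represented⇒∃∈𝔾 (represents-removeAt p rep-v)
        ... | H , H∈𝔾 , G∖p≈H with genericRepresentation? k (toℕ p) H in eq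
        ... | no ¬rep = contradiction
                (removeAt v p , generic , represents-resp-≈ (≈.sym G∖p≈H) (represents-removeAt p rep-v)) ¬rep
        -- The chosen word `w` may differ from `removeAt v p`, so `lookup v p` need not be the right
        -- letter; `insertion-exists` finds one that fits `w`.
        ... | yes (w , generic-w , rep-w)
          with insertion-exists generic-w v (represents-resp-≈ G∖p≈H rep-w) rep-v
        ... | l , rep = inj₁ (l , H) ,
                ∈-++⁺ˡ (∈-map⁺ inj₁ (∈-cartesianProduct⁺ (∈-letters l)
                  (∈-filter⁺ (_⊨? φ) H∈𝔾 (to (extends-stable ext) G⊨φ)))) ,
                ext
          where
          ext : Extends p l H G
          ext = extends generic-w rep-w eq rep

      -- A pair of a letter and a graph `H` goes to the extension of `H` by that letter, from which
      -- deleting `p` recovers `H` up to `_≈_` and genericity recovers the letter. If `H` has no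
      -- generic word, any of its words is nongeneric and codes `H`.
      count-suc-≥ : length L * count φ k n ≤ count φ k (suc n) + length L * length N
      count-suc-≥ = subst₂ _≤_ (length-cartesianProductWith _,_ L (models φ k n)) length-codes
        (length-≤ R (Unique.cartesianProduct⁺ (letters-unique k) (Unique.filter⁺ (_⊨? φ) (𝔾-unique-≡ k n))) total R-injective)
        where
        codes : List (Graph (suc n) ⊎ Letter k × Word k n)
        codes = List.map inj₁ (models φ k (suc n)) ++ List.map inj₂ (cartesianProduct L N)

        length-codes : length codes ≡ count φ k (suc n) + length L * length N
        length-codes = trans (length-++ (List.map inj₁ (models φ k (suc n)))) (cong₂ _+_
          (length-map inj₁ (models φ k (suc n)))
          (trans (length-map inj₂ (cartesianProduct L N)) (length-cartesianProductWith _,_ L N)))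

        R : Letter k × Graph n → Graph (suc n) ⊎ Letter k × Word k n → Set
        R (l , H) (inj₁ G)        = Extends p l H G
        R (l , H) (inj₂ (l′ , w)) = l ≡ l′ × Represents w H

        R-injective : ∀ {x x′ c} → x ∈ˡ cartesianProduct L (models φ k n) → x′ ∈ˡ cartesianProduct L (models φ k n) →
                      R x c → R x′ c → x ≡ x′
        R-injective {l , H} {l′ , H′} {c} x∈ x′∈ r r′ = same c r r′
          where
          graph-∈ : ∀ {x} → x ∈ˡ cartesianProduct L (models φ k n) → proj₂ x ∈ˡ 𝔾 k n
          graph-∈ x∈ = proj₁ (∈-filter⁻ (_⊨? φ) (proj₂ (∈-cartesianProduct⁻ L (models φ k n) x∈)))

          same : ∀ c → R (l , H) c → R (l′ , H′) c → (l , H) ≡ (l′ , H′)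
          same (inj₂ (_ , w)) (refl , rep) (refl , rep′) = cong (l ,_)
            (𝔾-≈-injective (graph-∈ x∈) (graph-∈ x′∈) (represents⇒≈ rep rep′))
          same (inj₁ G) r r′ with 𝔾-≈-injective (graph-∈ x∈) (graph-∈ x′∈)
            (≈.trans (extends⇒≈∖ r) (≈.sym (extends⇒≈∖ r′)))
          ... | refl = cong (_, H) (extends-injective r r′)

        total : ∀ {x} → x ∈ˡ cartesianProduct L (models φ k n) → ∃[ c ] (c ∈ˡ codes × R x c)
        total {l , H} x∈ with ∈-filter⁻ (_⊨? φ) {xs =
          𝔾 k n} (proj₂ (∈-cartesianProduct⁻ L (models φ k n) x∈))
        ... | H∈𝔾 , H⊨φ with genericRepresentation? k (toℕ p) H in eq
        ... | yes (w , generic , rep) with represented⇒∃∈𝔾 (represents-graph (insertAt w p l))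
        ... | G , G∈𝔾 , ≈G = inj₁ G ,
                ∈-++⁺ˡ (∈-map⁺ inj₁ (∈-filter⁺ (_⊨? φ) G∈𝔾 (from (extends-stable ext) H⊨φ))) ,
                ext
          where
          ext : Extends p l H G
          ext = extends generic rep eq (represents-resp-≈ (≈.sym ≈G) (represents-graph (insertAt w p l)))
        total {l , H} x∈ | H∈𝔾 , H⊨φ | no ¬rep with ∈𝔾⇒represented {k = k} H∈𝔾
        ... | w , rep = inj₂ (l , w) ,
                ∈-++⁺ʳ _ (∈-map⁺ inj₂ (∈-cartesianProduct⁺ (∈-letters l)
                  (¬generic⇒∈nonGeneric (toℕ p) w (λ generic → ¬rep (w , generic , rep))))) ,
                refl , rep

  -- The two sentences and their stability

  truth : Sentence
  truth = ¬′ ⊥′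

  hasIsolated : Sentence
  hasIsolated = ∃′ ∀′ ¬′ E (suc zero) zero

  truth-stable : Stable truth
  truth-stable = record
    { resp-≈          = λ _ t → t
    ; insertAt-stable = λ _ _ → mk⇔ (λ _ ()) (λ _ ())
    }

  count-truth : ∀ k n → count truth k n ≡ length (𝔾 k n)
  count-truth k n = cong length (filter-all (_⊨? truth) {xs = 𝔾 k n} (All.universal (λ _ ()) (𝔾 k n)))

  hasIsolated-resp-≈ : {G H : Graph n} → G ≈ H → G ⊨ hasIsolated → H ⊨ hasIsolated
  hasIsolated-resp-≈ (mk≈ G≈H) (x , isolated) = x , λ y x~y → isolated y (from (G≈H x y) x~y)

  -- No vertex before the position is isolated, nor is the inserted one: each has a late neighbour
  -- whose palette is its colour. An isolated vertex after the position has an empty palette, since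
  -- all colours occur earlier, so the inserted vertex cannot be adjacent to it.
  hasIsolated-stable : Stable hasIsolated
  hasIsolated-stable = record
    { resp-≈          = hasIsolated-resp-≈
    ; insertAt-stable = λ generic rep → mk⇔ (deleted generic rep) (inserted generic rep)
    }
    where
    late-adjacent : {w : Word k n} {p : Fin (suc n)} {G : Graph n} (generic : Generic (toℕ p) w) → Represents w G →
                    ∀ {x} → toℕ x < toℕ p → _~_ G x (Generic.late generic (colour w x))
    late-adjacent {w = w} generic rep {x} x<p = from (adjacency rep (<-≤-trans x<p (m≤late i)))
      (subst (i ∈_) (sym (palette-late i)) (x∈⁅x⁆ i))
      where
      open Generic generic
      i = colour w x

    deleted : {w : Word k n} {p : Fin (suc n)} {l : Letter k} {G : Graph (suc n)} → Generic (toℕ p) w →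
              Represents (insertAt w p l) G → G ⊨ hasIsolated → G ∖ p ⊨ hasIsolated
    deleted {p = p} {l} generic rep (x , isolated) with punchInView p x
    ... | punched x′ = x′ , λ y → isolated (punchIn p y)
    ... | pivot      = contradiction
      (from (represents-after rep (m≤late i)) (subst (i ∈_) (sym (palette-late i)) (x∈⁅x⁆ i)))
      (isolated _)
      where
      open Generic generic
      i = proj₁ l

    inserted : {w : Word k n} {p : Fin (suc n)} {l : Letter k} {G : Graph (suc n)} → Generic (toℕ p) w →
               Represents (insertAt w p l) G → G ∖ p ⊨ hasIsolated → G ⊨ hasIsolated
    inserted {w = w} {p} {l} {G} generic rep (x , isolated) with toℕ x <? toℕ p
    ... | yes x<p =
        contradiction (late-adjacent {p = p} generic (represents-∖ {G = G} rep) x<p) (isolated _)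
    ... | no  x≮p = punchIn p x , isolated′
      where
      open Generic generic
      p≤x = ≮⇒≥ x≮p

      isolated′ : ∀ y → ¬ _~_ G (punchIn p x) y
      isolated′ y with punchInView p y
      ... | punched y′ = isolated y′
      ... | pivot      =
          λ x~p → isolated (early i) $ ~-sym G $ from (adjacency (represents-∖ {G = G} rep) (<-≤-trans (early<m i) p≤x)) $
        subst (_∈ palette w x) (sym (colour-early i)) (to (represents-after rep p≤x) (~-sym G x~p))
        where i = proj₁ l

  -- Size of `𝔾` and vertices appended at the end

  length-𝔾-≤ : ∀ k n → length (𝔾 k n) ≤ (k * 2 ^ k) ^ n
  length-𝔾-≤ k n = subst (length (𝔾 k n) ≤_) (length-words k n) $
    length-≤ (λ G w → Represents w G) (𝔾-unique-≡ k n)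
      (λ G∈ → let w , rep = ∈𝔾⇒represented {k = k} G∈ in w , ∈-words w , rep)
      (λ G∈ G′∈ rep rep′ → 𝔾-≈-injective {k = k} G∈ G′∈ (represents⇒≈ rep rep′))

  -- Deleting the last vertex recovers the old graph without any genericity. The colour of the last
  -- vertex is never read, so its palette alone decides its neighbours: `∅` makes it isolated,
  -- `full` dominating.
  length-𝔾-≤-append : {P : Graph (suc n) → Set} (P? : Decidable P) → (∀ {G H} → G ≈ H → P G → P H) →
    (l : Letter k) → (∀ {w G} → Represents (insertAt w (fromℕ n) l) G → P G) →
    length (𝔾 k n) ≤ length (filter P? (𝔾 k (suc n)))
  length-𝔾-≤-append {n} {k} P? P-resp l append-P =
    length-≤ (λ H G → H ≈ G ∖ fromℕ n) (𝔾-unique-≡ k n) total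
      (λ H∈ H′∈ H≈ H′≈ → 𝔾-≈-injective {k = k} H∈ H′∈ (≈.trans H≈ (≈.sym H′≈)))
    where
    total : ∀ {H} → H ∈ˡ 𝔾 k n → ∃[ G ] (G ∈ˡ filter P? (𝔾 k (suc n)) × H ≈ G ∖ fromℕ n)
    total H∈ with ∈𝔾⇒represented {k = k} H∈
    ... | w , rep with represented⇒∃∈𝔾 (represents-graph (insertAt w (fromℕ n) l))
    ... | G , G∈ , ≈G =
        G , ∈-filter⁺ P? G∈ (append-P rep-G) , represents⇒≈ rep (represents-∖ {G = G} rep-G)
      where
      rep-G : Represents (insertAt w (fromℕ n) l) G
      rep-G = represents-resp-≈ (≈.sym ≈G) (represents-graph (insertAt w (fromℕ n) l))

  last-adjacency : {w : Word k n} {l : Letter k} {G : Graph (suc n)} → Represents (insertAt w (fromℕ n) l) G →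
                   ∀ x → _~_ G (punchIn (fromℕ n) x) (fromℕ n) ⇔ colour w x ∈ proj₂ l
  last-adjacency {n = n} rep x = represents-before rep (subst (toℕ x <_) (sym (toℕ-fromℕ n)) (toℕ<n x))

  length-𝔾-≤-hasIsolated : ∀ k .{{_ : NonZero k}} n → length (𝔾 k n) ≤ count hasIsolated k (suc n)
  length-𝔾-≤-hasIsolated (suc k) n =
    length-𝔾-≤-append {k = suc k} (_⊨? hasIsolated) hasIsolated-resp-≈ (zero , ∅)
    (λ {_} {G} rep → fromℕ n , isolated G rep)
    where
    isolated : ∀ {w} G → Represents (insertAt w (fromℕ n) (zero , ∅)) G → ∀ y → ¬ _~_ G (fromℕ n) y
    isolated G rep y with punchInView (fromℕ n) y
    ... | pivot     = ~-irrefl G refl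
    ... | punched x = λ e → contradiction (to (last-adjacency rep x) (~-sym G e)) ∉⊥

  -- The old graph has at least one vertex here because a dominating vertex that stands alone is
  -- itself isolated.
  length-𝔾-≤-¬hasIsolated : ∀ k .{{_ : NonZero k}} n →
    length (𝔾 k (suc n)) ≤ length (filter (¬? ∘ (_⊨? hasIsolated)) (𝔾 k (suc (suc n))))
  length-𝔾-≤-¬hasIsolated (suc k) n = length-𝔾-≤-append {k = suc k} (¬? ∘ (_⊨? hasIsolated))
    (λ G≈H ¬G H⊨ → ¬G (hasIsolated-resp-≈ (≈.sym G≈H) H⊨)) (zero , full)
    (λ {_} {G} rep (x , isolated) → notIsolated G rep x isolated)
    where
    notIsolated : ∀ {w} G → Represents (insertAt w (fromℕ (suc n)) (zero , full)) G → ∀ x → ¬ (∀ y → ¬ _~_ G x y)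
    notIsolated G rep x isolated with punchInView (fromℕ (suc n)) x
    ... | pivot      = isolated _ (~-sym G (from (last-adjacency rep zero) ∈⊤))
    ... | punched x′ = isolated _ (from (last-adjacency rep x′) ∈⊤)

  -- Every word of length j is inserted into a word in which all marks occur
  -- twice, between their two occurrences.
  module _ {k : ℕ} where
    seed : Word k (k + k)
    seed = tabulate mark Vec.++ tabulate mark

    seed-generic : Generic k seed
    seed-generic = record
      { early        = _↑ˡ k
      ; early<m      = λ i → subst (_< k) (sym (toℕ-↑ˡ i k)) (toℕ<n i)
      ; colour-early = λ i → cong proj₁ (trans (lookup-++ˡ (tabulate mark) _ i) (lookup∘tabulate mark i))
      ; late         = k ↑ʳ_
      ; m≤late       = λ i → subst (k ≤_) (sym (toℕ-↑ʳ k i)) (m≤m+n k _)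
      ; palette-late =
        λ i → cong proj₂ (trans (lookup-++ʳ (tabulate {n = k} mark) _ i) (lookup∘tabulate mark i))
      }

    private
      k<1+j+2k : ∀ j → k < suc (j + (k + k))
      k<1+j+2k j = s≤s (≤-trans (m≤m+n k k) (m≤n+m (k + k) j))

    position : ∀ j → Fin (suc (j + (k + k)))
    position j = fromℕ< (k<1+j+2k j)

    grow : ∀ {j} → Word k j → Word k (j + (k + k))
    grow         []      = seed
    grow {suc j} (l ∷ v) = insertAt (grow v) (position j) l

    grow-generic : ∀ {j} (v : Word k j) → Generic k (grow v)
    grow-generic         []      = seed-generic
    grow-generic {suc j} (l ∷ v) = subst (λ m → Generic m (grow (l ∷ v))) (toℕ-fromℕ< (k<1+j+2k j))
      (insertAt-generic (subst (λ m → Generic m (grow v)) (sym (toℕ-fromℕ< (k<1+j+2k j))) (grow-generic v)) l)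

    -- Deleting the vertex inserted last and recursing recovers the other letters. Once these agree,
    -- both graphs extend the same generic word, and `insertion-unique` yields the remaining letter.
    grow-injective : ∀ {j} (v v′ : Word k j) {G : Graph (j + (k + k))} →
                     Represents (grow v) G → Represents (grow v′) G → v ≡ v′
    grow-injective         []      []        rep rep′ = refl
    grow-injective {suc j} (l ∷ v) (l′ ∷ v′) rep rep′ with grow-injective v v′ (represents-∖ rep) (represents-∖ rep′)
    ... | refl = cong (_∷ v) (insertion-unique
      (subst (λ m → Generic m (grow v)) (sym (toℕ-fromℕ< (k<1+j+2k j))) (grow-generic v)) rep rep′)

    length-words-≤ : ∀ j → length (words k j) ≤ length (𝔾 k (j + (k + k)))
    length-words-≤ j = length-≤ (λ v G → Represents (grow v) G) (allVec-unique (letters-unique k) j)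
      (λ {v} _ → let G , G∈ , ≈G = represented⇒∃∈𝔾 (represents-graph (grow v)) in
        G , G∈ , represents-resp-≈ (≈.sym ≈G) (represents-graph (grow v)))
      (λ _ _ → grow-injective _ _)

  -- Multiplying by K^(2k) avoids the exponent n - 2k. For n < 2k it is enough that `𝔾 k n` is
  -- nonempty.
  length-𝔾-≥ : ∀ k .{{_ : NonZero k}} n → (k * 2 ^ k) ^ n ≤ length (𝔾 k n) * (k * 2 ^ k) ^ (k + k)
  length-𝔾-≥ k n with k + k ≤? n
  ... | yes 2k≤n = begin
    K ^ n                                    ≡⟨ cong (K ^_) (m∸n+n≡m 2k≤n) ⟨
    K ^ (n ∸ (k + k) + (k + k))              ≡⟨ ^-distribˡ-+-* K (n ∸ (k + k)) (k + k) ⟩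
    K ^ (n ∸ (k + k)) * K ^ (k + k)          ≡⟨ cong (_* K ^ (k + k)) (length-words k (n ∸ (k + k))) ⟨
    length (words k (n ∸ (k + k))) * K ^ (k + k)
      ≤⟨ *-monoˡ-≤ (K ^ (k + k)) (subst (λ j → length (words k (n ∸ (k + k))) ≤ length (𝔾 k j)) (m∸n+n≡m 2k≤n) (length-words-≤ (n ∸ (k + k)))) ⟩
    length (𝔾 k n) * K ^ (k + k)             ∎
    where
    open ≤-Reasoning
    K = k * 2 ^ k
  ... | no 2k≰n = begin
    K ^ n                          ≤⟨ ^-monoʳ-≤ K (<⇒≤ (≰⇒> 2k≰n)) ⟩
    K ^ (k + k)                    ≤⟨ m≤n*m (K ^ (k + k)) (length (𝔾 k n)) ⟩
    length (𝔾 k n) * K ^ (k + k)   ∎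
    where
    open ≤-Reasoning
    K = k * 2 ^ k
    instance
      _ = 𝔾-nonEmpty k n
      _ = m^n≢0 2 k
      K≢0 : NonZero K
      K≢0 = m*n≢0 k (2 ^ k)

  -- Comparing successive proportions

  -- Both B′ A and B A′ lie within K D A of K A B, by the recurrences and B ≤ A, so they differ by
  -- at most twice that. This is the comparison of B′/A′ with B/A, cleared of denominators.
  recurrence⇒cross-≤ : ∀ {A A′ B B′ K D} → B ≤ A → A′ ≤ K * A + K * D → K * A ≤ A′ + K * D →
                       B′ ≤ K * B + K * D → K * B ≤ B′ + K * D →
                       (B′ * A ≤ B * A′ + 2 * (K * D * A)) × (B * A′ ≤ B′ * A + 2 * (K * D * A))
  recurrence⇒cross-≤ {A} {A′} {B} {B′} {K} {D} B≤A A′≤ ≤A′ B′≤ ≤B′ =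
    (begin
      B′ * A                                ≤⟨ *-monoˡ-≤ A B′≤ ⟩
      (K * B + K * D) * A                   ≡⟨ eq₁ A B K D ⟩
      B * (K * A) + K * D * A               ≤⟨ +-monoˡ-≤ (K * D * A) (*-monoʳ-≤ B ≤A′) ⟩
      B * (A′ + K * D) + K * D * A          ≡⟨ eq₂ A A′ B K D ⟩
      B * A′ + (K * D * A + K * D * B)
        ≤⟨ +-monoʳ-≤ (B * A′) (+-monoʳ-≤ (K * D * A) (*-monoʳ-≤ (K * D) B≤A)) ⟩
      B * A′ + (K * D * A + K * D * A)      ≡⟨ eq₃ (B * A′) (K * D * A) ⟩
      B * A′ + 2 * (K * D * A)              ∎) ,
    (begin
      B * A′                                ≤⟨ *-monoʳ-≤ B A′≤ ⟩
      B * (K * A + K * D)                   ≡⟨ eq₄ A B K D ⟩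
      K * B * A + K * D * B                 ≤⟨ +-mono-≤ (*-monoˡ-≤ A ≤B′) (*-monoʳ-≤ (K * D) B≤A) ⟩
      (B′ + K * D) * A + K * D * A          ≡⟨ eq₅ A B′ (K * D) ⟩
      B′ * A + 2 * (K * D * A)              ∎)
    where
    open ≤-Reasoning
    eq₁ : ∀ A B K D → (K * B + K * D) * A ≡ B * (K * A) + K * D * A
    eq₁ = solve-∀
    eq₂ : ∀ A A′ B K D → B * (A′ + K * D) + K * D * A ≡ B * A′ + (K * D * A + K * D * B)
    eq₂ = solve-∀
    eq₃ : ∀ x y → x + (y + y) ≡ x + 2 * y
    eq₃ = solve-∀
    eq₄ : ∀ A B K D → B * (K * A + K * D) ≡ K * B * A + K * D * B
    eq₄ = solve-∀
    eq₅ : ∀ A B′ y → (B′ + y) * A + y * A ≡ B′ * A + 2 * (y * A)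
    eq₅ = solve-∀

  module _ (k : ℕ) .{{_ : NonZero k}} where
    -- In `C`, a factor 2 comes from `recurrence⇒cross-≤`, the factor 2k from `length-nonGeneric`,
    -- and K^(2k) from `length-𝔾-≥`.
    K q C : ℕ
    K = k * 2 ^ k
    q = pred K
    C = 4 * k * K ^ (k + k)

    private
      A B : ℕ → ℕ
      A n = length (𝔾 k n)
      B n = count hasIsolated k n

    ⌊n/2⌋≤n∸⌊n/2⌋ : ∀ n → ⌊ n /2⌋ ≤ n ∸ ⌊ n /2⌋
    ⌊n/2⌋≤n∸⌊n/2⌋ n = begin
      ⌊ n /2⌋          ≤⟨ ⌊n/2⌋≤⌈n/2⌉ n ⟩
      ⌈ n /2⌉          ≡⟨ m+n∸m≡n ⌊ n /2⌋ ⌈ n /2⌉ ⟨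
      ⌊ n /2⌋ + ⌈ n /2⌉ ∸ ⌊ n /2⌋  ≡⟨ cong (_∸ ⌊ n /2⌋) (⌊n/2⌋+⌈n/2⌉≡n n) ⟩
      n ∸ ⌊ n /2⌋      ∎
      where open ≤-Reasoning

    -- Counts at n and n + 1 are compared by deleting the vertex in the middle.
    cross-≤ : ∀ n → let h = ⌊ n /2⌋ ; error = C * q ^ h * (A n * A (suc n)) in
              (B (suc n) * A n * K ^ h ≤ B n * A (suc n) * K ^ h + error) ×
              (B n * A (suc n) * K ^ h ≤ B (suc n) * A n * K ^ h + error)
    cross-≤ n = let cross , cross′ = recurrence⇒cross-≤ {A n} {A (suc n)} {B n} {B (suc n)} {K} {D}
                      (length-filter (_⊨? hasIsolated) (𝔾 k n))
                      (subst₂ (λ x y → x ≤ K * y + K * D) (count-truth k (suc n)) (count-truth k n) (upper truth-stable))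
                      (subst₂ (λ x y → K * y ≤ x + K * D) (count-truth k (suc n)) (count-truth k n) (lower truth-stable))
                      (upper hasIsolated-stable)
                      (lower hasIsolated-stable)
                in scale (B n * A (suc n)) cross , scale (B (suc n) * A n) cross′
      where
      h = ⌊ n /2⌋
      p : Fin (suc n)
      p = fromℕ< (s≤s (⌊n/2⌋≤n n))

      D = length (nonGeneric k h n)

      upper : ∀ {φ} → Stable φ → count φ k (suc n) ≤ K * count φ k n + K * D
      upper {φ} stable =
        subst₂ (λ L h → count φ k (suc n) ≤ L * count φ k n + L * length (nonGeneric k h n))
        (length-letters k) (toℕ-fromℕ< (s≤s (⌊n/2⌋≤n n))) (count-suc-≤ stable k p)

      lower : ∀ {φ} → Stable φ → K * count φ k n ≤ count φ k (suc n) + K * D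
      lower {φ} stable =
        subst₂ (λ L h → L * count φ k n ≤ count φ k (suc n) + L * length (nonGeneric k h n))
        (length-letters k) (toℕ-fromℕ< (s≤s (⌊n/2⌋≤n n))) (count-suc-≥ stable k p)

      -- Since D ≤ 2k q^h K^(n-h), the factor K K^h completes the power to K^(n+1), which is at most
      -- K^(2k) A(n+1). Divided by A(n) A(n+1) K^h, the error is C (q/K)^h.
      error-≤ : 2 * (K * D * A n) * K ^ h ≤ C * q ^ h * (A n * A (suc n))
      error-≤ = begin
        2 * (K * D * A n) * K ^ h
          ≤⟨ *-monoˡ-≤ (K ^ h) (*-monoʳ-≤ 2 (*-monoˡ-≤ (A n) (*-monoʳ-≤ K (length-nonGeneric k (⌊n/2⌋≤n∸⌊n/2⌋ n) (⌊n/2⌋≤n n))))) ⟩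
        2 * (K * (k * (2 * (q ^ h * K ^ (n ∸ h)))) * A n) * K ^ h
          ≡⟨ eq₁ K k (q ^ h) (K ^ (n ∸ h)) (A n) (K ^ h) ⟩
        4 * k * q ^ h * A n * (K * (K ^ (n ∸ h) * K ^ h))
          ≡⟨ cong (λ x → 4 * k * q ^ h * A n * (K * x)) (^-distribˡ-+-* K (n ∸ h) h) ⟨
        4 * k * q ^ h * A n * (K * K ^ (n ∸ h + h))
          ≡⟨ cong (λ x → 4 * k * q ^ h * A n * K ^ suc x) (m∸n+n≡m (⌊n/2⌋≤n n)) ⟩
        4 * k * q ^ h * A n * K ^ suc n
          ≤⟨ *-monoʳ-≤ (4 * k * q ^ h * A n) (length-𝔾-≥ k (suc n)) ⟩
        4 * k * q ^ h * A n * (A (suc n) * K ^ (k + k))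
          ≡⟨ eq₂ (4 * k) (q ^ h) (A n) (A (suc n)) (K ^ (k + k)) ⟩
        C * q ^ h * (A n * A (suc n))  ∎
        where
        open ≤-Reasoning
        eq₁ : ∀ K k x y A z → 2 * (K * (k * (2 * (x * y))) * A) * z ≡ 4 * k * x * A * (K * (y * z))
        eq₁ = solve-∀
        eq₂ : ∀ x y A A′ z → x * y * A * (A′ * z) ≡ x * z * y * (A * A′)
        eq₂ = solve-∀

      scale : ∀ {X} Y → X ≤ Y + 2 * (K * D * A n) → X * K ^ h ≤ Y * K ^ h + C * q ^ h * (A n * A (suc n))
      scale {X} Y X≤ = begin
        X * K ^ h                                    ≤⟨ *-monoˡ-≤ (K ^ h) X≤ ⟩
        (Y + 2 * (K * D * A n)) * K ^ h              ≡⟨ *-distribʳ-+ (K ^ h) Y _ ⟩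
        Y * K ^ h + 2 * (K * D * A n) * K ^ h        ≤⟨ +-monoʳ-≤ (Y * K ^ h) error-≤ ⟩
        Y * K ^ h + C * q ^ h * (A n * A (suc n))    ∎
        where open ≤-Reasoning

    -- Bounds the growth of |𝔾 k n| in one step; 1/M becomes the distance that the proportions keep
    -- from 0 and 1.
    M : ℕ
    M = K * K ^ (k + k)

    length-𝔾-suc-≤ : ∀ n → A (suc n) ≤ M * A n
    length-𝔾-suc-≤ n = begin
      A (suc n)                      ≤⟨ length-𝔾-≤ k (suc n) ⟩
      K * K ^ n                      ≤⟨ *-monoʳ-≤ K (length-𝔾-≥ k n) ⟩
      K * (A n * K ^ (k + k))        ≡⟨ eq K (A n) (K ^ (k + k)) ⟩
      M * A n                        ∎
      where
      open ≤-Reasoning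
      eq : ∀ x y z → x * (y * z) ≡ x * z * y
      eq = solve-∀

    length-𝔾-≤-count : ∀ n → A (suc n) ≤ M * B (suc n)
    length-𝔾-≤-count n = ≤-trans (length-𝔾-suc-≤ n) (*-monoʳ-≤ M (length-𝔾-≤-hasIsolated k n))

    -- The graphs without isolated vertices make up at least a share 1/M; the additive form avoids
    -- truncated subtraction.
    count-≤-length-𝔾 : ∀ n → M * B (2 + n) + A (2 + n) ≤ M * A (2 + n)
    count-≤-length-𝔾 n = begin
      M * B (2 + n) + A (2 + n)
        ≤⟨ +-monoʳ-≤ (M * B (2 + n)) (≤-trans (length-𝔾-suc-≤ (suc n)) (*-monoʳ-≤ M (length-𝔾-≤-¬hasIsolated k n))) ⟩
      M * B (2 + n) + M * length (filter (¬? ∘ (_⊨? hasIsolated)) (𝔾 k (2 + n)))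
                                                    ≡⟨ *-distribˡ-+ M (B (2 + n)) _ ⟨
      M * (B (2 + n) + length (filter (¬? ∘ (_⊨? hasIsolated)) (𝔾 k (2 + n))))
                                                    ≡⟨ cong (M *_) (length-filter-¬ (_⊨? hasIsolated) (𝔾 k (2 + n))) ⟩
      M * A (2 + n)                                 ∎
      where open ≤-Reasoning

module Estimates where

  open import Data.Integer.Base as ℤ using (+_; +[1+_]; -[1+_])
  import Data.Integer.Properties as ℤₚ
  open import Data.Nat.Base as ℕ using (zero; suc; ⌊_/2⌋; ⌈_/2⌉; _^_; s≤s)
  import Data.Nat.Properties as ℕₚ
  open import Data.Nat.Tactic.RingSolver using (solve-∀)
  open import Data.Rational.Base hiding (NonZero)
  open import Data.Rational.Properties
  open import Data.Rational.Solver using (module +-*-Solver)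
  open import Data.Rational.Unnormalised.Base as ℚᵘ using (mkℚᵘ; *≡*; *≤*; *<*)
  import Data.Rational.Unnormalised.Properties as ℚᵘₚ
  open +-*-Solver using (solve; _:+_; _:*_; :-_; _:-_; _:=_; con)

  -- From inequalities in ℕ to estimates in ℚ

  ι : ℕ → ℚ
  ι n = + n / 1

  toℚᵘ-/ : ∀ n d → toℚᵘ (n / suc d) ℚᵘ.≃ mkℚᵘ n d
  toℚᵘ-/ n d = toℚᵘ-fromℚᵘ (mkℚᵘ n d)

  ι-+ : ∀ a b → ι (a ℕ.+ b) ≡ ι a + ι b
  ι-+ a b = toℚᵘ-injective (begin
    toℚᵘ (ι (a ℕ.+ b))            ≈⟨ toℚᵘ-/ (+ (a ℕ.+ b)) 0 ⟩
    mkℚᵘ (+ (a ℕ.+ b)) 0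
      ≈⟨ *≡* (cong (λ z → z ℤ.* + 1) (sym (cong₂ ℤ._+_ (ℤₚ.*-identityʳ (+ a)) (ℤₚ.*-identityʳ (+ b))))) ⟩
    mkℚᵘ (+ a) 0 ℚᵘ.+ mkℚᵘ (+ b) 0  ≈⟨ ℚᵘₚ.+-cong (toℚᵘ-/ (+ a) 0) (toℚᵘ-/ (+ b) 0) ⟨
    toℚᵘ (ι a) ℚᵘ.+ toℚᵘ (ι b)    ≈⟨ toℚᵘ-homo-+ (ι a) (ι b) ⟨
    toℚᵘ (ι a + ι b)              ∎)
    where open ℚᵘₚ.≃-Reasoning

  ι-* : ∀ a b → ι (a ℕ.* b) ≡ ι a * ι b
  ι-* a b = toℚᵘ-injective (begin
    toℚᵘ (ι (a ℕ.* b))            ≈⟨ toℚᵘ-/ (+ (a ℕ.* b)) 0 ⟩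
    mkℚᵘ (+ (a ℕ.* b)) 0          ≈⟨ *≡* (cong (λ z → z ℤ.* + 1) (ℤₚ.pos-* a b)) ⟩
    mkℚᵘ (+ a) 0 ℚᵘ.* mkℚᵘ (+ b) 0  ≈⟨ ℚᵘₚ.*-cong (toℚᵘ-/ (+ a) 0) (toℚᵘ-/ (+ b) 0) ⟨
    toℚᵘ (ι a) ℚᵘ.* toℚᵘ (ι b)    ≈⟨ toℚᵘ-homo-* (ι a) (ι b) ⟨
    toℚᵘ (ι a * ι b)              ∎)
    where open ℚᵘₚ.≃-Reasoning

  /-*-cancel : ∀ a b .{{_ : NonZero b}} → (+ a / b) * ι b ≡ ι a
  /-*-cancel a (suc b) = toℚᵘ-injective (begin
    toℚᵘ ((+ a / suc b) * ι (suc b))            ≈⟨ toℚᵘ-homo-* (+ a / suc b) (ι (suc b)) ⟩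
    toℚᵘ (+ a / suc b) ℚᵘ.* toℚᵘ (ι (suc b))    ≈⟨ ℚᵘₚ.*-cong (toℚᵘ-/ (+ a) b) (toℚᵘ-/ (+ suc b) 0) ⟩
    mkℚᵘ (+ a) b ℚᵘ.* mkℚᵘ (+ suc b) 0
      ≈⟨ *≡* (trans (ℤₚ.*-identityʳ (+ a ℤ.* + suc b)) (cong (λ d → + a ℤ.* + d) (sym (ℕₚ.*-identityʳ (suc b))))) ⟩
    mkℚᵘ (+ a) 0                                ≈⟨ toℚᵘ-/ (+ a) 0 ⟨
    toℚᵘ (ι a)                                  ∎)
    where open ℚᵘₚ.≃-Reasoning

  ι-mono-≤ : ∀ {a b} → a ℕ.≤ b → ι a ≤ ι b
  ι-mono-≤ {a} {b} a≤b = toℚᵘ-cancel-≤ (begin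
    toℚᵘ (ι a)    ≃⟨ toℚᵘ-/ (+ a) 0 ⟩
    mkℚᵘ (+ a) 0  ≤⟨ *≤* (ℤₚ.*-monoʳ-≤-nonNeg (+ 1) (ℤ.+≤+ a≤b)) ⟩
    mkℚᵘ (+ b) 0  ≃⟨ toℚᵘ-/ (+ b) 0 ⟨
    toℚᵘ (ι b)    ∎)
    where open ℚᵘₚ.≤-Reasoning

  ι-mono-< : ∀ {a b} → a ℕ.< b → ι a < ι b
  ι-mono-< {a} {b} a<b = toℚᵘ-cancel-< (begin-strict
    toℚᵘ (ι a)    ≃⟨ toℚᵘ-/ (+ a) 0 ⟩
    mkℚᵘ (+ a) 0  <⟨ *<* (ℤₚ.*-monoʳ-<-pos (+ 1) (ℤ.+<+ a<b)) ⟩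
    mkℚᵘ (+ b) 0  ≃⟨ toℚᵘ-/ (+ b) 0 ⟨
    toℚᵘ (ι b)    ∎)
    where open ℚᵘₚ.≤-Reasoning

  ι-nonNegative : ∀ n → NonNegative (ι n)
  ι-nonNegative n = nonNegative (ι-mono-≤ {0} {n} ℕ.z≤n)

  ι-positive : ∀ n .{{_ : NonZero n}} → Positive (ι n)
  ι-positive n = positive (ι-mono-< {0} {n} (ℕ.>-nonZero⁻¹ n))

  -- The denominator serves as `D`: multiplied by it, a positive rational becomes its numerator, a
  -- positive integer.
  archimedean : ∀ ε → 0ℚ < ε → ∃[ D ] (1ℚ ≤ ε * ι D)
  archimedean ε@(mkℚ +[1+ a ] d _) 0<ε = suc d , (begin
    1ℚ                                ≤⟨ ι-mono-≤ {1} {suc a} (s≤s ℕ.z≤n) ⟩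
    ι (suc a)                         ≡⟨ /-*-cancel (suc a) (suc d) ⟨
    (+ suc a / suc d) * ι (suc d)     ≡⟨ cong (_* ι (suc d)) (↥p/↧p≡p ε) ⟩
    ε * ι (suc d)                     ∎)
    where open ≤-Reasoning
  archimedean (mkℚ (+ 0) d _)    (*<* (ℤ.+<+ ()))
  archimedean (mkℚ -[1+ a ] d _) (*<* ())

  ∣-∣-comm : ∀ p q → ∣ p - q ∣ ≡ ∣ q - p ∣
  ∣-∣-comm p q =
    trans (sym (∣-p∣≡∣p∣ (p - q))) (cong ∣_∣ (solve 2 (λ p q → :- (p :- q) := q :- p) refl p q))

  ≤+⇒∣-∣≤ : ∀ {p q d} → p ≤ q + d → q ≤ p + d → ∣ p - q ∣ ≤ d
  ≤+⇒∣-∣≤ {p} {q} {d} p≤ q≤ with ∣p∣≡p∨∣p∣≡-p (p - q)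
  ... | inj₁ eq = begin
    ∣ p - q ∣    ≡⟨ eq ⟩
    p - q        ≤⟨ +-monoˡ-≤ (- q) p≤ ⟩
    q + d - q    ≡⟨ solve 2 (λ q d → q :+ d :- q := d) refl q d ⟩
    d            ∎
    where open ≤-Reasoning
  ... | inj₂ eq = begin
    ∣ p - q ∣    ≡⟨ eq ⟩
    - (p - q)    ≡⟨ solve 2 (λ p q → :- (p :- q) := q :- p) refl p q ⟩
    q - p        ≤⟨ +-monoˡ-≤ (- p) q≤ ⟩
    p + d - p    ≡⟨ solve 2 (λ p d → p :+ d :- p := d) refl p d ⟩
    d            ∎
    where open ≤-Reasoning

  -- The fractions x = B/A, x′ = B′/A′ and ρ = Q/P are given by their defining products, so
  -- multiplying by A A′ P reduces the claim to the inequality in ℕ.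
  cross-≤⇒≤+ : ∀ {x x′ A A′ P Q} B B′ C ρ .{{_ : NonZero A}} .{{_ : NonZero A′}} .{{_ : NonZero P}} →
               x * ι A ≡ ι B → x′ * ι A′ ≡ ι B′ → ρ * ι P ≡ ι Q →
               B′ ℕ.* A ℕ.* P ℕ.≤ B ℕ.* A′ ℕ.* P ℕ.+ C ℕ.* Q ℕ.* (A ℕ.* A′) →
               x′ ≤ x + ι C * ρ
  cross-≤⇒≤+ {x} {x′} {A} {A′} {P} {Q} B B′ C ρ x-eq x′-eq ρ-eq cross =
    *-cancelʳ-≤-pos (ι N) {{ι-positive N {{N≢0}}}} (begin
      x′ * ι N                                          ≡⟨ cong (x′ *_) ι-N ⟩
      x′ * (ι A * ι A′ * ι P)
        ≡⟨ solve 4 (λ x a a′ p → x :* (a :* a′ :* p) := x :* a′ :* a :* p) refl x′ (ι A) (ι A′) (ι P) ⟩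
      x′ * ι A′ * ι A * ι P                             ≡⟨ cong (λ z → z * ι A * ι P) x′-eq ⟩
      ι B′ * ι A * ι P                                  ≡⟨ cong (_* ι P) (ι-* B′ A) ⟨
      ι (B′ ℕ.* A) * ι P                                ≡⟨ ι-* (B′ ℕ.* A) P ⟨
      ι (B′ ℕ.* A ℕ.* P)                                ≤⟨ ι-mono-≤ cross ⟩
      ι (B ℕ.* A′ ℕ.* P ℕ.+ C ℕ.* Q ℕ.* (A ℕ.* A′))     ≡⟨ ι-+ (B ℕ.* A′ ℕ.* P) _ ⟩
      ι (B ℕ.* A′ ℕ.* P) + ι (C ℕ.* Q ℕ.* (A ℕ.* A′))
        ≡⟨ cong₂ _+_ (trans (ι-* (B ℕ.* A′) P) (cong (_* ι P) (ι-* B A′)))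
                                                            (trans (ι-* (C ℕ.* Q) (A ℕ.* A′)) (cong₂ _*_ (ι-* C Q) (ι-* A A′))) ⟩
      ι B * ι A′ * ι P + ι C * ι Q * (ι A * ι A′)
        ≡⟨ cong₂ (λ b q → b * ι A′ * ι P + ι C * q * (ι A * ι A′)) x-eq ρ-eq ⟨
      x * ι A * ι A′ * ι P + ι C * (ρ * ι P) * (ι A * ι A′)
        ≡⟨ solve 6 (λ x a a′ p c r → x :* a :* a′ :* p :+ c :* (r :* p) :* (a :* a′) := (x :+ c :* r) :* (a :* a′ :* p))
             refl x (ι A) (ι A′) (ι P) (ι C) ρ ⟩
      (x + ι C * ρ) * (ι A * ι A′ * ι P)                ≡⟨ cong ((x + ι C * ρ) *_) ι-N ⟨
      (x + ι C * ρ) * ι N                               ∎)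
    where
    open ≤-Reasoning
    N = A ℕ.* A′ ℕ.* P

    N≢0 : NonZero N
    N≢0 = ℕₚ.m*n≢0 (A ℕ.* A′) P {{ℕₚ.m*n≢0 A A′}}

    ι-N : ι N ≡ ι A * ι A′ * ι P
    ι-N = trans (ι-* (A ℕ.* A′) P) (cong (_* ι P) (ι-* A A′))

  -- Geometric decay and the Cauchy property

  module Geometric (q : ℕ) where

    ρ : ℕ → ℚ
    ρ zero    = 1ℚ
    ρ (suc m) = (+ q / suc q) * ρ m

    ρ-* : ∀ m → ρ m * ι (suc q ^ m) ≡ ι (q ^ m)
    ρ-* zero    = refl
    ρ-* (suc m) = begin
      r * ρ m * ι (suc q ℕ.* suc q ^ m)       ≡⟨ cong (r * ρ m *_) (ι-* (suc q) (suc q ^ m)) ⟩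
      r * ρ m * (ι (suc q) * ι (suc q ^ m))
        ≡⟨ solve 4 (λ a b c d → a :* b :* (c :* d) := (a :* c) :* (b :* d)) refl r (ρ m) (ι (suc q)) (ι (suc q ^ m)) ⟩
      (r * ι (suc q)) * (ρ m * ι (suc q ^ m)) ≡⟨ cong₂ _*_ (/-*-cancel q (suc q)) (ρ-* m) ⟩
      ι q * ι (q ^ m)                         ≡⟨ ι-* q (q ^ m) ⟨
      ι (q ℕ.* q ^ m)                         ∎
      where
      open ≡-Reasoning
      r = + q / suc q

    -- As (q + 1) r = q for the ratio r = q/(q + 1), each term `ρ m` is a difference of consecutive
    -- values of (q + 1) ρ. This sums the geometric series by telescoping.
    ρ-suc : ∀ m → ι (suc q) * ρ m ≡ ι (suc q) * ρ (suc m) + ρ m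
    ρ-suc m = begin
      ι (suc q) * ρ m                         ≡⟨ cong (_* ρ m) (ι-+ 1 q) ⟩
      (1ℚ + ι q) * ρ m                        ≡⟨ cong (λ z → (1ℚ + z) * ρ m) (/-*-cancel q (suc q)) ⟨
      (1ℚ + r * ι (suc q)) * ρ m
        ≡⟨ solve 3 (λ r k p → (con 1ℚ :+ r :* k) :* p := k :* (r :* p) :+ p) refl r (ι (suc q)) (ρ m) ⟩
      ι (suc q) * (r * ρ m) + ρ m             ∎
      where
      open ≡-Reasoning
      r = + q / suc q

    ρ-nonNegative : ∀ m → NonNegative (ρ m)
    ρ-nonNegative zero    = _
    ρ-nonNegative (suc m) =
      nonNeg*nonNeg⇒nonNeg (+ q / suc q) {{normalize-nonNeg q (suc q)}} (ρ m) {{ρ-nonNegative m}}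

    -- A Bernoulli-type bound. It gives decay of `ρ m` at the rate q/m, which makes the tails small
    -- with an explicit threshold and without logarithms.
    m*q^m≤q*[1+q]^m : ∀ m → m ℕ.* q ^ m ℕ.≤ q ℕ.* suc q ^ m
    m*q^m≤q*[1+q]^m zero    = ℕ.z≤n
    m*q^m≤q*[1+q]^m (suc m) = begin
      suc m ℕ.* (q ℕ.* q ^ m)                           ≡⟨ eq₁ m q (q ^ m) ⟩
      q ℕ.* q ^ m ℕ.+ q ℕ.* (m ℕ.* q ^ m)
        ≤⟨ ℕₚ.+-mono-≤ (ℕₚ.*-monoʳ-≤ q (ℕₚ.^-monoˡ-≤ m (ℕₚ.n≤1+n q))) (ℕₚ.*-monoʳ-≤ q (m*q^m≤q*[1+q]^m m)) ⟩
      q ℕ.* suc q ^ m ℕ.+ q ℕ.* (q ℕ.* suc q ^ m)       ≡⟨ eq₂ q (suc q ^ m) ⟩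
      q ℕ.* (suc q ℕ.* suc q ^ m)                       ∎
      where
      open ℕₚ.≤-Reasoning
      eq₁ : ∀ m q x → suc m ℕ.* (q ℕ.* x) ≡ q ℕ.* x ℕ.+ q ℕ.* (m ℕ.* x)
      eq₁ = solve-∀
      eq₂ : ∀ q x → q ℕ.* x ℕ.+ q ℕ.* (q ℕ.* x) ≡ q ℕ.* (suc q ℕ.* x)
      eq₂ = solve-∀

    m*ρ≤q : ∀ m → ι m * ρ m ≤ ι q
    m*ρ≤q m = *-cancelʳ-≤-pos (ι (suc q ^ m)) {{ι-positive (suc q ^ m) {{ℕₚ.m^n≢0 (suc q) m}}}} (begin
      ι m * ρ m * ι (suc q ^ m)      ≡⟨ *-assoc (ι m) (ρ m) _ ⟩
      ι m * (ρ m * ι (suc q ^ m))    ≡⟨ cong (ι m *_) (ρ-* m) ⟩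
      ι m * ι (q ^ m)                ≡⟨ ι-* m (q ^ m) ⟨
      ι (m ℕ.* q ^ m)                ≤⟨ ι-mono-≤ (m*q^m≤q*[1+q]^m m) ⟩
      ι (q ℕ.* suc q ^ m)            ≡⟨ ι-* q (suc q ^ m) ⟩
      ι q * ι (suc q ^ m)            ∎)
      where open ≤-Reasoning

    module Telescope (C : ℕ) (x : ℕ → ℚ) (step : ∀ n → ∣ x (suc n) - x n ∣ ≤ ι C * ρ ⌊ n /2⌋) where

      -- The bounds on the steps telescope: u n - u (suc n) = ι C * ρ ⌊ n /2⌋.
      u : ℕ → ℚ
      u n = ι C * (ι (suc q) * (ρ ⌊ n /2⌋ + ρ ⌈ n /2⌉))

      -- From n to n + 1 the pair (⌊n/2⌋, ⌈n/2⌉) becomes (⌈n/2⌉, ⌊n/2⌋ + 1), by computation. So one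
      -- summand of `u` merely moves, and `ρ-suc` gives the drop in the other.
      u-suc : ∀ n → u n ≡ ι C * ρ ⌊ n /2⌋ + u (suc n)
      u-suc n = begin
        c * (k * (s + b))
          ≡⟨ solve 4 (λ c k s b → c :* (k :* (s :+ b)) := c :* (k :* s :+ k :* b)) refl c k s b ⟩
        c * (k * s + k * b)               ≡⟨ cong (λ z → c * (z + k * b)) (ρ-suc ⌊ n /2⌋) ⟩
        c * (k * s′ + s + k * b)
          ≡⟨ solve 5 (λ c k s s′ b → c :* (k :* s′ :+ s :+ k :* b) := c :* s :+ c :* (k :* (b :+ s′))) refl c k s s′ b ⟩
        c * s + c * (k * (b + s′))        ∎
        where
        open ≡-Reasoning
        c = ι C
        k = ι (suc q)
        s = ρ ⌊ n /2⌋
        s′ = ρ (suc ⌊ n /2⌋)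
        b = ρ ⌈ n /2⌉

      0≤u : ∀ n → 0ℚ ≤ u n
      0≤u n = nonNegative⁻¹ (u n) {{nonNeg*nonNeg⇒nonNeg (ι C) {{ι-nonNegative C}} _
        {{nonNeg*nonNeg⇒nonNeg (ι (suc q)) {{ι-nonNegative (suc q)}} _
          {{nonNeg+nonNeg⇒nonNeg (ρ ⌊ n /2⌋) {{ρ-nonNegative ⌊ n /2⌋}} (ρ ⌈ n /2⌉) {{ρ-nonNegative ⌈ n /2⌉}}}}}}}}

      -- The remaining `u (j + n)` is kept on the left so that the induction closes: each further
      -- step is paid for by the drop of `u`.
      tail+u≤u : ∀ j n → ∣ x (j ℕ.+ n) - x n ∣ + u (j ℕ.+ n) ≤ u n
      tail+u≤u zero    n =
        ≤-reflexive (trans (cong (λ z → ∣ z ∣ + u n) (+-inverseʳ (x n))) (+-identityˡ (u n)))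
      tail+u≤u (suc j) n = begin
        ∣ x₂ - x₀ ∣ + u₂
          ≡⟨ cong (λ z → ∣ z ∣ + u₂) (solve 3 (λ s b c → s :- c := s :- b :+ (b :- c)) refl x₂ x₁ x₀) ⟩
        ∣ x₂ - x₁ + (x₁ - x₀) ∣ + u₂
          ≤⟨ +-monoˡ-≤ u₂ (∣p+q∣≤∣p∣+∣q∣ (x₂ - x₁) (x₁ - x₀)) ⟩
        ∣ x₂ - x₁ ∣ + ∣ x₁ - x₀ ∣ + u₂
          ≤⟨ +-monoˡ-≤ u₂ (+-monoˡ-≤ ∣ x₁ - x₀ ∣ (step (j ℕ.+ n))) ⟩
        d + ∣ x₁ - x₀ ∣ + u₂
          ≡⟨ solve 3 (λ s b c → s :+ b :+ c := b :+ (s :+ c)) refl d (∣ x₁ - x₀ ∣) u₂ ⟩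
        ∣ x₁ - x₀ ∣ + (d + u₂)
          ≡⟨ cong (λ z → ∣ x₁ - x₀ ∣ + z) (u-suc (j ℕ.+ n)) ⟨
        ∣ x₁ - x₀ ∣ + u (j ℕ.+ n)                           ≤⟨ tail+u≤u j n ⟩
        u n                                                 ∎
        where
        open ≤-Reasoning
        x₀ = x n
        x₁ = x (j ℕ.+ n)
        x₂ = x (suc j ℕ.+ n)
        u₂ = u (suc j ℕ.+ n)
        d  = ι C * ρ ⌊ j ℕ.+ n /2⌋

      tail≤u : ∀ {m n} → m ℕ.≤ n → ∣ x n - x m ∣ ≤ u m
      tail≤u {m} {n} m≤n = begin
        ∣ x n - x m ∣                          ≡⟨ cong (λ j → ∣ x j - x m ∣) (ℕₚ.m∸n+n≡m m≤n) ⟨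
        ∣ x (j ℕ.+ m) - x m ∣                  ≡⟨ +-identityʳ _ ⟨
        ∣ x (j ℕ.+ m) - x m ∣ + 0ℚ             ≤⟨ +-monoʳ-≤ (∣ x (j ℕ.+ m) - x m ∣) (0≤u (j ℕ.+ m)) ⟩
        ∣ x (j ℕ.+ m) - x m ∣ + u (j ℕ.+ m)    ≤⟨ tail+u≤u j m ⟩
        u m                                    ∎
        where
        open ≤-Reasoning
        j = n ℕ.∸ m

      T : ℕ
      T = C ℕ.* (suc q ℕ.* (q ℕ.+ q))

      ⌊n/2⌋*u≤T : ∀ n → ι ⌊ n /2⌋ * u n ≤ ι T
      ⌊n/2⌋*u≤T n = begin
        m * (c * (k * (s + b)))
          ≡⟨ solve 5 (λ m c k s b → m :* (c :* (k :* (s :+ b))) := c :* (k :* (m :* s :+ m :* b))) refl m c k s b ⟩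
        c * (k * (m * s + m * b))
          ≤⟨ *-monoˡ-≤-nonNeg c {{ι-nonNegative C}} (*-monoˡ-≤-nonNeg k {{ι-nonNegative (suc q)}} (+-mono-≤ (m*ρ≤q ⌊ n /2⌋)
               (≤-trans (*-monoʳ-≤-nonNeg b {{ρ-nonNegative ⌈ n /2⌉}} (ι-mono-≤ (ℕₚ.⌊n/2⌋≤⌈n/2⌉ n))) (m*ρ≤q ⌈ n /2⌉)))) ⟩
        c * (k * (ι q + ι q))         ≡⟨ cong (λ z → c * (k * z)) (ι-+ q q) ⟨
        c * (k * ι (q ℕ.+ q))         ≡⟨ cong (c *_) (ι-* (suc q) (q ℕ.+ q)) ⟨
        c * ι (suc q ℕ.* (q ℕ.+ q))   ≡⟨ ι-* C (suc q ℕ.* (q ℕ.+ q)) ⟨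
        ι T                           ∎
        where
        open ≤-Reasoning
        m = ι ⌊ n /2⌋
        c = ι C
        k = ι (suc q)
        s = ρ ⌊ n /2⌋
        b = ρ ⌈ n /2⌉

      u-small : ∀ ε → 0ℚ < ε → ∃[ N ] (∀ n → N ℕ.≤ n → u n < ε)
      u-small ε 0<ε with archimedean ε 0<ε
      ... | D , 1≤εD = N , small
        where
        -- Doubled so that ⌊n/2⌋ > T D for n ≥ N. Then ⌊n/2⌋ u(n) ≤ T ≤ T D ε < ⌊n/2⌋ ε, and ⌊n/2⌋
        -- cancels.
        N = suc (T ℕ.* D) ℕ.+ suc (T ℕ.* D)

        small : ∀ n → N ℕ.≤ n → u n < ε
        small n N≤n = *-cancelˡ-<-nonNeg (ι ⌊ n /2⌋) {{ι-nonNegative ⌊ n /2⌋}} (begin-strict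
          ι ⌊ n /2⌋ * u n         ≤⟨ ⌊n/2⌋*u≤T n ⟩
          ι T                     ≡⟨ *-identityʳ (ι T) ⟨
          ι T * 1ℚ                ≤⟨ *-monoˡ-≤-nonNeg (ι T) {{ι-nonNegative T}} 1≤εD ⟩
          ι T * (ε * ι D)
            ≡⟨ solve 3 (λ t e d → t :* (e :* d) := t :* d :* e) refl (ι T) ε (ι D) ⟩
          ι T * ι D * ε           ≡⟨ cong (_* ε) (ι-* T D) ⟨
          ι (T ℕ.* D) * ε         <⟨ *-monoˡ-<-pos ε {{positive 0<ε}} (ι-mono-< TD<n/2) ⟩
          ι ⌊ n /2⌋ * ε           ∎)
          where
          open ≤-Reasoning
          TD<n/2 : T ℕ.* D ℕ.< ⌊ n /2⌋
          TD<n/2 = subst (ℕ._≤ ⌊ n /2⌋) (sym (ℕₚ.n≡⌊n+n/2⌋ (suc (T ℕ.* D)))) (ℕₚ.⌊n/2⌋-mono N≤n)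

      cauchy : ∀ ε → 0ℚ < ε → ∃[ N ] (∀ m n → N ℕ.≤ m → N ℕ.≤ n → ∣ x m - x n ∣ < ε)
      cauchy ε 0<ε = N , close
        where
        N = proj₁ (u-small ε 0<ε)
        small = proj₂ (u-small ε 0<ε)

        close : ∀ m n → N ℕ.≤ m → N ℕ.≤ n → ∣ x m - x n ∣ < ε
        close m n N≤m N≤n with ℕₚ.≤-total m n
        ... | inj₁ m≤n = subst (_< ε) (∣-∣-comm (x n) (x m)) (≤-<-trans (tail≤u m≤n) (small m N≤m))
        ... | inj₂ n≤m = ≤-<-trans (tail≤u n≤m) (small n N≤n)

module Convergence where

  open Combinatorics
  open Estimates
  open import Data.Integer.Base using (+_)
  open import Data.List.Base using (length)
  open import Data.Nat.Base as ℕ using (suc; ⌊_/2⌋; _^_; s≤s; z≤n)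
  import Data.Nat.Properties as ℕₚ
  open import Data.Rational.Base hiding (NonZero; _≃_)
  open import Data.Rational.Properties
  open import Data.Rational.Solver using (module +-*-Solver)
  open +-*-Solver using (solve; _:+_; _:*_; _:-_; _:=_)

  -- The limit and its distance from 0 and 1

  p≤∣p∣ : ∀ p → p ≤ ∣ p ∣
  p≤∣p∣ p with ≤-total 0ℚ p
  ... | inj₁ 0≤p = ≤-reflexive (sym (0≤p⇒∣p∣≡p 0≤p))
  ... | inj₂ p≤0 = ≤-trans p≤0 (0≤∣p∣ p)

  module _ (k : ℕ) .{{k≢0 : NonZero k}} where
    private
      x : ℕ → ℚ
      x = proportion hasIsolated k

      A B : ℕ → ℕ
      A n = length (𝔾 k n)
      B n = count hasIsolated k n

      K≢0 : NonZero (K k)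
      K≢0 = ℕₚ.m*n≢0 k (2 ^ k) {{k≢0}} {{ℕₚ.m^n≢0 2 k}}

      M≢0 : NonZero (M k)
      M≢0 = ℕₚ.m*n≢0 (K k) _ {{K≢0}} {{ℕₚ.m^n≢0 (K k) (k ℕ.+ k) {{K≢0}}}}

      x-* : ∀ n → x n * ι (A n) ≡ ι (B n)
      x-* n = /-*-cancel (B n) (A n) {{𝔾-nonEmpty k n}}

    open Geometric (q k)

    step : ∀ n → ∣ x (suc n) - x n ∣ ≤ ι (C k) * ρ ⌊ n /2⌋
    step n = ≤+⇒∣-∣≤ {x (suc n)} {x n}
      (cross-≤⇒≤+ {x n} {x (suc n)} (B n) (B (suc n)) (C k) (ρ m)
        {{𝔾-nonEmpty k n}} {{𝔾-nonEmpty k (suc n)}} {{K^m≢0}} (x-* n) (x-* (suc n)) ρ-eq (proj₁ (cross-≤ k n)))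
      (cross-≤⇒≤+ {x (suc n)} {x n} (B (suc n)) (B n) (C k) (ρ m)
        {{𝔾-nonEmpty k (suc n)}} {{𝔾-nonEmpty k n}} {{K^m≢0}} (x-* (suc n)) (x-* n) ρ-eq
        (subst (λ z → B n ℕ.* A (suc n) ℕ.* K k ^ m ℕ.≤ B (suc n) ℕ.* A n ℕ.* K k ^ m ℕ.+ C k ℕ.* q k ^ m ℕ.* z)
          (ℕₚ.*-comm (A n) (A (suc n))) (proj₂ (cross-≤ k n))))
      where
      m = ⌊ n /2⌋
      K^m≢0 = ℕₚ.m^n≢0 (K k) m {{K≢0}}

      ρ-eq : ρ m * ι (K k ^ m) ≡ ι (q k ^ m)
      ρ-eq = subst (λ K → ρ m * ι (K ^ m) ≡ ι (q k ^ m)) (ℕₚ.suc-pred (K k) {{K≢0}}) (ρ-* m)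

    open Telescope (C k) x step

    limit : ℝ
    limit = record { approx = x ; cauchy = cauchy }

    -- The approximations of `limit` are the proportions themselves, so this is `cauchy` at some δ
    -- strictly between 0 and ε; the gap between δ and ε is what `∣_−_∣<_` requires.
    proportion⟶limit : x ⟶ limit
    proportion⟶limit ε 0<ε =
      let δ , 0<δ , δ<ε = <-dense 0<ε
          N , close     = cauchy δ 0<δ
      in N , λ n N≤n → δ , δ<ε , N , λ m N≤m → <⇒≤ (close n m N≤n N≤m)

    private
      ε₀ : ℚ
      ε₀ = (+ 1 / M k) {{M≢0}}

      ε₀-* : ε₀ * ι (M k) ≡ 1ℚ
      ε₀-* = /-*-cancel 1 (M k) {{M≢0}}

      0<ε₀ : 0ℚ < ε₀
      0<ε₀ = *-cancelʳ-<-nonNeg (ι (M k)) {{ι-nonNegative (M k)}}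
        (subst₂ _<_ (sym (*-zeroˡ (ι (M k)))) (sym ε₀-*) (ι-mono-< {0} {1} (s≤s z≤n)))

      cancel : ∀ n {p q} → p * (ι (M k) * ι (A n)) ≤ q * (ι (M k) * ι (A n)) → p ≤ q
      cancel n = *-cancelʳ-≤-pos (ι (M k) * ι (A n))
        {{subst Positive (ι-* (M k) (A n)) (ι-positive (M k ℕ.* A n) {{ℕₚ.m*n≢0 (M k) (A n) {{M≢0}} {{𝔾-nonEmpty k n}}}})}}

    ε₀≤proportion : ∀ n → ε₀ ≤ x (suc n)
    ε₀≤proportion n = cancel (suc n) (begin
      ε₀ * (m * α)           ≡⟨ *-assoc ε₀ m α ⟨
      ε₀ * m * α             ≡⟨ cong (_* α) ε₀-* ⟩
      1ℚ * α                 ≡⟨ *-identityˡ α ⟩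
      α                      ≤⟨ ι-mono-≤ (length-𝔾-≤-count k n) ⟩
      ι (M k ℕ.* B (suc n))  ≡⟨ ι-* (M k) (B (suc n)) ⟩
      m * ι (B (suc n))      ≡⟨ cong (m *_) (x-* (suc n)) ⟨
      m * (x (suc n) * α)    ≡⟨ solve 3 (λ m x α → m :* (x :* α) := x :* (m :* α)) refl m (x (suc n)) α ⟩
      x (suc n) * (m * α)    ∎)
      where
      open ≤-Reasoning
      m = ι (M k)
      α = ι (A (suc n))

    proportion+ε₀≤1 : ∀ n → x (2 ℕ.+ n) + ε₀ ≤ 1ℚ
    proportion+ε₀≤1 n = cancel (2 ℕ.+ n) (begin
      (p + ε₀) * (m * α)
        ≡⟨ solve 4 (λ p e m α → (p :+ e) :* (m :* α) := m :* (p :* α) :+ e :* m :* α) refl p ε₀ m α ⟩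
      m * (p * α) + ε₀ * m * α
        ≡⟨ cong₂ (λ y z → m * y + z * α) (x-* (2 ℕ.+ n)) ε₀-* ⟩
      m * ι (B (2 ℕ.+ n)) + 1ℚ * α
        ≡⟨ cong₂ _+_ (sym (ι-* (M k) (B (2 ℕ.+ n)))) (*-identityˡ α) ⟩
      ι (M k ℕ.* B (2 ℕ.+ n)) + α                     ≡⟨ ι-+ (M k ℕ.* B (2 ℕ.+ n)) (A (2 ℕ.+ n)) ⟨
      ι (M k ℕ.* B (2 ℕ.+ n) ℕ.+ A (2 ℕ.+ n))         ≤⟨ ι-mono-≤ (count-≤-length-𝔾 k n) ⟩
      ι (M k ℕ.* A (2 ℕ.+ n))                         ≡⟨ ι-* (M k) (A (2 ℕ.+ n)) ⟩
      m * α                                           ≡⟨ *-identityˡ (m * α) ⟨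
      1ℚ * (m * α)                                    ∎)
      where
      open ≤-Reasoning
      m = ι (M k)
      α = ι (A (2 ℕ.+ n))
      p = x (2 ℕ.+ n)

    limit≄0 : ¬ limit ≃ 0ℝ
    limit≄0 limit≃0 = <-irrefl refl (≤-<-trans ε₀≤ (close (2 ℕ.+ N) (ℕₚ.m≤n+m N 2)))
      where
      N = proj₁ (limit≃0 ε₀ 0<ε₀)
      close = proj₂ (limit≃0 ε₀ 0<ε₀)

      ε₀≤ : ε₀ ≤ ∣ x (2 ℕ.+ N) - 0ℚ ∣
      ε₀≤ = begin
        ε₀                     ≤⟨ ε₀≤proportion (suc N) ⟩
        x (2 ℕ.+ N)            ≡⟨ +-identityʳ (x (2 ℕ.+ N)) ⟨
        x (2 ℕ.+ N) - 0ℚ       ≤⟨ p≤∣p∣ (x (2 ℕ.+ N) - 0ℚ) ⟩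
        ∣ x (2 ℕ.+ N) - 0ℚ ∣   ∎
        where open ≤-Reasoning

    limit≄1 : ¬ limit ≃ 1ℝ
    -- The index 2 + N lies beyond N and in the range of `proportion+ε₀≤1`, which begins at 2
    -- because a dominating vertex needs a companion in a nonempty old graph.
    limit≄1 limit≃1 = <-irrefl refl (≤-<-trans ε₀≤ (close (2 ℕ.+ N) (ℕₚ.m≤n+m N 2)))
      where
      N = proj₁ (limit≃1 ε₀ 0<ε₀)
      close = proj₂ (limit≃1 ε₀ 0<ε₀)

      ε₀≤ : ε₀ ≤ ∣ x (2 ℕ.+ N) - 1ℚ ∣
      ε₀≤ = begin
        ε₀                       ≡⟨ solve 2 (λ e p → e := p :+ e :- p) refl ε₀ p ⟩
        p + ε₀ - p               ≤⟨ +-monoˡ-≤ (- p) (proportion+ε₀≤1 N) ⟩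
        1ℚ - p                   ≤⟨ p≤∣p∣ (1ℚ - p) ⟩
        ∣ 1ℚ - p ∣               ≡⟨ ∣-∣-comm 1ℚ p ⟩
        ∣ p - 1ℚ ∣               ∎
        where
        open ≤-Reasoning
        p = x (2 ℕ.+ N)

open Combinatorics using (hasIsolated)
open Convergence using (limit; proportion⟶limit; limit≄0; limit≄1)

theorem4p1 : Σ[ φ ∈ Sentence ] (∀ (k : ℕ) .{{_ : NonZero k}} →
    ∃[ L ] ((proportion φ k ⟶ L) × ¬ (L ≃ 0ℝ ⊎ L ≃ 1ℝ)))
theorem4p1 = hasIsolated , λ k → limit k , proportion⟶limit k , [ limit≄0 k , limit≄1 k ]′
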